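{- Let $N=(G=(V,E),\sigma,u,s)$ be a skew-symmetric network. Then the maximum value of an IS-flow in $N$ equals the minimum capacity $u(\mathcal B)$ over all odd $s$-barriers $\mathcal B$ for $(G,u)$.
   Context: A skew-symmetric graph is a finite directed graph $G=(V,E)$ (parallel arcs allowed) with a map $\sigma$ of $V\cup E$ onto itself such that $\sigma(x)\ne x$, $\sigma(\sigma(x))=x$ for all $x$, $\sigma(V)=V$, and for each arc $a$ from $v$ to $w$, $\sigma(a)$ is an arc from $\sigma(w)$ to $\sigma(v)$. A function on $E$ is symmetric if it takes equal values on $a$ and $\sigma(a)$. A skew-symmetric network is $N=(G,\sigma,u,s)$ with $u:E\to\mathbb Z_{\ge0}$ symmetric and source $s$; $s'=\sigma(s)$. A flow is $f:E\to\mathbb R_{\ge0}$ with $f\le u$ and flow conservation at each node other than $s,s'$; its value is the net outflow at $s$. An IS-flow is an integer-valued symmetric flow. For $X,Y\subseteq V$, $u(X,Y)$ denotes the total capacity of arcs from $X$ to $Y$. An odd $s$-barrier is a tuple $\mathcal B=(A;X_1,\dots,X_k)$ ($k\ge0$) such that: (O1) $A,X_1,\dots,X_k$ are pairwise disjoint subsets of $V$ and $s\in A$; (O2) $A\cap\sigma(A)=\emptyset$; (O3) $\sigma(X_i)=X_i$ for each $i$; (O4) $u(A,X_i)$ is odd for each $i$; (O5) for $i\neq j$ no arc of positive capacity connects $X_i$ and $X_j$ (in either direction); (O6) with $M:=V\setminus(A\cup\sigma(A)\cup X_1\cup\dots\cup X_k)$, no arc of positive capacity connects $X_i$ and $M$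 for any $i$. Its capacity is $u(\mathcal B):=u(A,V\setminus A)-k$. -}

module Defs where

open import Algebra.Properties.CommutativeMonoid.Sum using () renaming (sum to ∑)
open import Data.Bool.Base using (if_then_else_)
open import Data.Fin.Base using (Fin)
open import Data.Fin.Properties using (any?; _≟_)
open import Data.Fin.Subset using (Subset; _∈_; _∪_; _∩_; ∁; ⋃; Empty)
open import Data.Fin.Subset.Properties using (_∈?_)
open import Data.Integer.Base as ℤ using (ℤ; _⊖_)
open import Data.List.Base using (tabulate)
open import Data.Nat.Base using (ℕ; _≤_; _<_; _%_)
open import Data.Nat.Properties using (+-0-commutativeMonoid)
open import Data.Product.Base using (∃; _×_)
open import Data.Sum.Base using (_⊎_)
import Data.Vec.Base as Vec
open import Relation.Binary.PropositionalEquality.Core using (_≡_; _≢_)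
open import Relation.Nullary using (¬_; does; _×-dec_)
open import Relation.Unary using (Pred; Decidable)

sumOver : ∀ {m ℓ} {P : Pred (Fin m) ℓ} → Decidable P → (Fin m → ℕ) → ℕ
sumOver P? g = ∑ +-0-commutativeMonoid (λ e → if does (P? e) then g e else 0)

image : ∀ {n} → (Fin n → Fin n) → Subset n → Subset n
image φ X = Vec.tabulate (λ v → does (any? (λ w → (w ∈? X) ×-dec (φ w ≟ v))))

-- The node set is Fin n and the arc set is Fin m; σ is given by its
-- restrictions to nodes and to arcs.
record SkewSymmetricGraph (n m : ℕ) : Set where
  field
    src tgt      : Fin m → Fin n
    σV           : Fin n → Fin n
    σE           : Fin m → Fin m
    σV-fixfree   : ∀ v → σV v ≢ v
    σE-fixfree   : ∀ a → σE a ≢ a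
    σV-invol     : ∀ v → σV (σV v) ≡ v
    σE-invol     : ∀ a → σE (σE a) ≡ a
    src-σE       : ∀ a → src (σE a) ≡ σV (tgt a)
    tgt-σE       : ∀ a → tgt (σE a) ≡ σV (src a)

  Symmetric : (Fin m → ℕ) → Set
  Symmetric g = ∀ a → g (σE a) ≡ g a

record SkewSymmetricNetwork (n m : ℕ) : Set where
  field
    graph : SkewSymmetricGraph n m

  open SkewSymmetricGraph graph public

  field
    u           : Fin m → ℕ
    u-symmetric : Symmetric u
    s           : Fin n

  s′ : Fin n
  s′ = σV s

module _ {n m : ℕ} (N : SkewSymmetricNetwork n m) where
  open SkewSymmetricNetwork N

  outflow inflow : (Fin m → ℕ) → Fin n → ℕ
  outflow f v = sumOver (λ a → src a ≟ v) f
  inflow  f v = sumOver (λ a → tgt a ≟ v) f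

  -- Flows are nonnegative, so an integer-valued one takes values in ℕ.
  record ISFlow : Set where
    field
      f            : Fin m → ℕ
      capacity     : ∀ a → f a ≤ u a
      conservation : ∀ v → v ≢ s → v ≢ s′ → outflow f v ≡ inflow f v
      symmetric    : Symmetric f

  flowValue : ISFlow → ℤ
  flowValue F = outflow f s ⊖ inflow f s
    where open ISFlow F

  capacityBetween : Subset n → Subset n → ℕ
  capacityBetween X Y = sumOver (λ a → (src a ∈? X) ×-dec (tgt a ∈? Y)) u

  Connects : Fin m → Subset n → Subset n → Set
  Connects a X Y = (src a ∈ X × tgt a ∈ Y) ⊎ (src a ∈ Y × tgt a ∈ X)

  NoPositiveArc : Subset n → Subset n → Set
  NoPositiveArc X Y = ¬ (∃ λ a → 0 < u a × Connects a X Y)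

  record OddBarrier : Set where
    field
      k : ℕ
      A : Subset n
      X : Fin k → Subset n

    M : Subset n
    M = ∁ (A ∪ image σV A ∪ ⋃ (tabulate X))

    field
      A-X-disjoint  : ∀ i → Empty (A ∩ X i)
      X-X-disjoint  : ∀ i j → i ≢ j → Empty (X i ∩ X j)
      s∈A           : s ∈ A
      A-σA-disjoint : Empty (A ∩ image σV A)
      X-σ-invariant : ∀ i → image σV (X i) ≡ X i
      A-X-odd       : ∀ i → capacityBetween A (X i) % 2 ≡ 1
      X-X-noArc     : ∀ i j → i ≢ j → NoPositiveArc (X i) (X j)
      X-M-noArc     : ∀ i → NoPositiveArc (X i) M

  barrierCapacity : OddBarrier → ℤ
  barrierCapacity B = capacityBetween A (∁ A) ⊖ k
    where open OddBarrier B

-- Both require the extremal value to be attained.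
IsMaximumOf IsMinimumOf : {S : Set} → (S → ℤ) → ℤ → Set
IsMaximumOf g z = (∃ λ x → g x ≡ z) × (∀ x → g x ℤ.≤ z)
IsMinimumOf g z = (∃ λ x → g x ≡ z) × (∀ x → z ℤ.≤ g x)

{-# OPTIONS --safe #-}
module Submission where

-- For an IS-flow f, a cut A ∋ s has u(A, V∖A) = value(f) + r(A, V∖A), where r are
-- the residual capacities.  Conservation, summed over one node of each pair
-- {v, σ v} in X, shows that f(A, X) + f(X, A) is even, so the network and its
-- residual network have the same odd barriers.  Thus weak duality is the trivial
-- bound k ≤ r(A, V∖A), and equality has to be attained for a maximum flow.
--
-- Call a walk regular if it can be augmented together with its mirror image.  If
-- no regular residual walk leads from s to s′, take for A the nodes v such that v
-- is reached by a regular walk and σ v is not, and for the Xᵢ the components of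
-- the set of nodes v such that v and σ v are both reached.  The crux is that each
-- component C has exactly one residual arc from A, and that its capacity is 1.
-- This goes by induction on the total capacity: let e₀ be the arc through which
-- some regular walk first enters C, and keep only C and one unit of e₀ and σ e₀,
-- with the tail of e₀ as source.  The structure of this smaller network forces
-- all of C to be reachable from e₀ inside C.  If there were another entry e into
-- C, one could enter through e₀ and leave through σ e, and so reach σ of the
-- tail of e, which lies in A.

open import Defs
open import Algebra.Properties.CommutativeMonoid.Sum using ()
open import Algebra.Properties.CommutativeSemigroup using (interchange)
open import Data.Bool.Base using (Bool; true; false; if_then_else_; _∧_)
open import Data.Bool.Properties using (if-eta)
open import Data.Empty using (⊥; ⊥-elim)
open import Data.Fin.Base using (Fin; zero; suc; _↑ˡ_; _↑ʳ_; splitAt; join)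
open import Data.Fin.Permutation using (permutation)
open import Data.Fin.Properties
  using (_≟_; any?; all?; suc-injective; <-cmp; _<?_; ↑ˡ-injective; ↑ʳ-injective; splitAt-↑ˡ; splitAt-↑ʳ;
         join-splitAt)
open import Data.Fin.Subset using (Subset; _∈_; _∉_; _∪_; _∩_; ∁; ⋃; Empty)
open import Data.Fin.Subset.Properties
  using (_∈?_; anySubset?; x∈p∪q⁺; x∈p∪q⁻; x∈p∩q⁻; x∈p∩q⁺; x∈∁p⇒x∉p; x∉p⇒x∈∁p; ∉⊥; ⊆-antisym)
open import Data.Integer.Base as ℤ using (ℤ; _⊖_)
import Data.Integer.Properties as ℤₚ
open import Data.List.Base using (List; []; _∷_; [_]; _++_; length; tabulate)
open import Data.List.Relation.Unary.All as All using (All; []; _∷_)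
open import Data.Nat.Base using (ℕ; zero; suc; _+_; _*_; _∸_; _≤_; _<_; _%_; z≤n; s≤s)
open import Data.Nat.DivMod using ([m+kn]%n≡m%n)
open import Data.Nat.Induction using (<-wellFounded)
open import Data.Nat.Properties
  hiding (suc-injective; <-cmp; _≟_; _≤?_; _<?_)
open import Data.Nat.Properties using () renaming (_≟_ to _≟ℕ_; _≤?_ to _≤?ℕ_; _<?_ to _<?ℕ_)
open import Data.Nat.Tactic.RingSolver using (solve-∀)
open import Data.Product.Base using (∃; ∃-syntax; _×_; _,_; proj₁; proj₂)
open import Data.Sum.Base using (_⊎_; inj₁; inj₂; [_,_]′; swap; map₂)
import Data.Vec.Base as Vec
open import Data.Vec.Properties using (lookup∘tabulate; []=⇒lookup; lookup⇒[]=)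
open import Function.Base using (_∘_)
open import Induction.WellFounded using (Acc; acc)
open import Level using (0ℓ)
open import Relation.Binary.Definitions using (tri<; tri≈; tri>)
open import Relation.Binary.PropositionalEquality hiding ([_])
open import Relation.Nullary
open import Relation.Nullary.Decidable using (dec-true; dec-false; decidable-stable; map′; _→-dec_)
open import Relation.Unary using (Pred; Decidable)

open Algebra.Properties.CommutativeMonoid.Sum +-0-commutativeMonoid
  using (sum; sum-cong-≗; ∑-distrib-+; ∑-comm; sum-permute; sum-replicate-zero)

private
  variable
    m n : ℕ

  +-interchange : ∀ w x y z → (w + x) + (y + z) ≡ (w + y) + (x + z)
  +-interchange = interchange +-commutativeSemigroup

-- Finite sums and subsets

if-yes : ∀ {ℓ a} {P : Set ℓ} {B : Set a} (P? : Dec P) {x y : B} → P → (if does P? then x else y) ≡ x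
if-yes P? p = cong (if_then _ else _) (dec-true P? p)

if-no : ∀ {ℓ a} {P : Set ℓ} {B : Set a} (P? : Dec P) {x y : B} → ¬ P → (if does P? then x else y) ≡ y
if-no P? ¬p = cong (if_then _ else _) (dec-false P? ¬p)

subsetOf : {P : Pred (Fin n) 0ℓ} → Decidable P → Subset n
subsetOf P? = Vec.tabulate (does ∘ P?)

∈-subsetOf⁺ : {P : Pred (Fin n) 0ℓ} (P? : Decidable P) {v : Fin n} → P v → v ∈ subsetOf P?
∈-subsetOf⁺ P? {v} Pv =
  lookup⇒[]= v _ (trans (lookup∘tabulate (does ∘ P?) v) (dec-true (P? v) Pv))

∈-subsetOf⁻ : {P : Pred (Fin n) 0ℓ} (P? : Decidable P) {v : Fin n} → v ∈ subsetOf P? → P v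
∈-subsetOf⁻ P? {v} v∈ = decidable-stable (P? v) λ ¬Pv → contradiction
  (trans (sym (dec-false (P? v) ¬Pv)) (trans (sym (lookup∘tabulate (does ∘ P?) v)) ([]=⇒lookup v∈)))
  λ ()

δ : Fin n → Fin n → ℕ
δ i j = if does (i ≟ j) then 1 else 0

δ-refl : (i : Fin n) → δ i i ≡ 1
δ-refl i with i ≟ i
... | yes _   = refl
... | no  i≢i = contradiction refl i≢i

δ-≢ : {i j : Fin n} → i ≢ j → δ i j ≡ 0
δ-≢ {i = i} {j} i≢j with i ≟ j
... | yes i≡j = contradiction i≡j i≢j
... | no  _   = refl

sum-mono-≤ : {f g : Fin n → ℕ} → (∀ i → f i ≤ g i) → sum f ≤ sum g
sum-mono-≤ {zero}  f≤g = z≤n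
sum-mono-≤ {suc n} f≤g = +-mono-≤ (f≤g zero) (sum-mono-≤ (f≤g ∘ suc))

sum-mono-< : {f g : Fin n → ℕ} → (∀ i → f i ≤ g i) → ∀ i → f i < g i → sum f < sum g
sum-mono-< f≤g zero    fi<gi = +-mono-<-≤ fi<gi (sum-mono-≤ (f≤g ∘ suc))
sum-mono-< f≤g (suc i) fi<gi = +-mono-≤-< (f≤g zero) (sum-mono-< (f≤g ∘ suc) i fi<gi)

sum-zero : {f : Fin n → ℕ} → (∀ i → f i ≡ 0) → sum f ≡ 0
sum-zero {n} f≡0 = trans (sum-cong-≗ f≡0) (sum-replicate-zero n)

sum-*ˡ : ∀ c (f : Fin n → ℕ) → sum (λ i → c * f i) ≡ c * sum f
sum-*ˡ {zero}  c f = sym (*-zeroʳ c)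
sum-*ˡ {suc n} c f = trans (cong (c * f zero +_) (sum-*ˡ c (f ∘ suc))) (sym (*-distribˡ-+ c _ _))

sum-single : {f : Fin n → ℕ} (i : Fin n) → (∀ j → j ≢ i → f j ≡ 0) → sum f ≡ f i
sum-single {f = f} zero    f≡0 =
  trans (cong (f zero +_) (sum-zero (λ j → f≡0 (suc j) λ ()))) (+-identityʳ _)
sum-single {f = f} (suc i) f≡0 =
  trans (cong (_+ sum (f ∘ suc)) (f≡0 zero λ ()))
        (sum-single i (λ j j≢i → f≡0 (suc j) λ { refl → j≢i refl }))

sum-δ : (j : Fin n) → sum (λ i → δ i j) ≡ 1
sum-δ j = trans (sum-single j (λ _ → δ-≢)) (δ-refl j)

sum-↑ : ∀ k (f : Fin (k + m) → ℕ) → sum f ≡ sum (λ i → f (i ↑ˡ m)) + sum (λ i → f (k ↑ʳ i))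
sum-↑ zero    f = refl
sum-↑ {m} (suc k) f = trans (cong (f zero +_) (sum-↑ k (f ∘ suc))) (sym (+-assoc (f zero) _ _))

sum-fibres : (c : Fin n → ℕ) (φ : Fin m → Fin n) (g : Fin m → ℕ) →
             sum (λ v → c v * sumOver (λ a → φ a ≟ v) g) ≡ sum (λ a → c (φ a) * g a)
sum-fibres c φ g = begin
  sum (λ v → c v * sumOver (λ a → φ a ≟ v) g)
    ≡⟨ sum-cong-≗ (λ v → sym (sum-*ˡ (c v) (λ a → if does (φ a ≟ v) then g a else 0))) ⟩
  sum (λ v → sum (λ a → c v * (if does (φ a ≟ v) then g a else 0)))
    ≡⟨ ∑-comm (λ v a → c v * (if does (φ a ≟ v) then g a else 0)) ⟩
  sum (λ a → sum (λ v → c v * (if does (φ a ≟ v) then g a else 0)))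
    ≡⟨ sum-cong-≗ (λ a → trans (sum-single (φ a) (off a)) (on a)) ⟩
  sum (λ a → c (φ a) * g a) ∎
  where
  open ≡-Reasoning
  off : ∀ a v → v ≢ φ a → c v * (if does (φ a ≟ v) then g a else 0) ≡ 0
  off a v v≢ rewrite dec-false (φ a ≟ v) (v≢ ∘ sym) = *-zeroʳ (c v)
  on : ∀ a → c (φ a) * (if does (φ a ≟ φ a) then g a else 0) ≡ c (φ a) * g a
  on a rewrite dec-true (φ a ≟ φ a) refl = refl

module _ (σ : Fin n → Fin n) (σ-invol : ∀ i → σ (σ i) ≡ i) where

  sum-involution : (f : Fin n → ℕ) → sum f ≡ sum (f ∘ σ)
  sum-involution f = sum-permute f (permutation σ σ σ-invol σ-invol)

  sum-pairs : (∀ i → σ i ≢ i) → (f : Fin n → ℕ) →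
              sum f ≡ sum (λ i → if does (i <? σ i) then f i + f (σ i) else 0)
  sum-pairs σ-fixfree f = begin
    sum f
      ≡⟨ sum-cong-≗ split ⟩
    sum (λ i → lower i + upper i)
      ≡⟨ ∑-distrib-+ lower upper ⟩
    sum lower + sum upper
      ≡⟨ cong (sum lower +_) (sum-involution upper) ⟩
    sum lower + sum (upper ∘ σ)
      ≡⟨ ∑-distrib-+ lower (upper ∘ σ) ⟨
    sum (λ i → lower i + upper (σ i))
      ≡⟨ sum-cong-≗ merge ⟩
    sum (λ i → if does (i <? σ i) then f i + f (σ i) else 0) ∎
    where
    open ≡-Reasoning
    lower upper : Fin _ → ℕ
    lower i = if does (i <? σ i) then f i else 0
    upper i = if does (i <? σ i) then 0 else f i
    split : ∀ i → f i ≡ lower i + upper i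
    split i with does (i <? σ i)
    ... | true  = sym (+-identityʳ (f i))
    ... | false = refl
    merge : ∀ i → lower i + upper (σ i) ≡ (if does (i <? σ i) then f i + f (σ i) else 0)
    merge i rewrite σ-invol i with <-cmp i (σ i)
    ... | tri< i<σi _ σi≮i rewrite dec-true (i <? σ i) i<σi | dec-false (σ i <? i) σi≮i = refl
    ... | tri≈ _ i≡σi _ = contradiction (sym i≡σi) (σ-fixfree i)
    ... | tri> i≮σi _ σi<i rewrite dec-false (i <? σ i) i≮σi | dec-true (σ i <? i) σi<i = refl

-- Regular walks

anyList? : ∀ {ℓ} k {P : List (Fin m) → Set ℓ} → Decidable P → Dec (∃ λ p → length p ≤ k × P p)
anyList? zero    P? =
  map′ (λ P[] → [] , z≤n , P[]) (λ { ([] , _ , P[]) → P[] }) (P? [])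
anyList? (suc k) P? =
  map′ (λ { (inj₁ P[])               → [] , z≤n , P[]
          ; (inj₂ (a , p , p≤k , Pp)) → a ∷ p , s≤s p≤k , Pp })
       (λ { ([] , _ , P[])             → inj₁ P[]
          ; (a ∷ p , s≤s p≤k , Pp)      → inj₂ (a , p , p≤k , Pp) })
       (P? [] ⊎-dec any? (λ a → anyList? k (P? ∘ (a ∷_))))

count : Fin m → List (Fin m) → ℕ
count a []      = 0
count a (b ∷ p) = δ a b + count a p

count-++ : ∀ (a : Fin m) p q → count a (p ++ q) ≡ count a p + count a q
count-++ a []      q = refl
count-++ a (b ∷ p) q = trans (cong (δ a b +_) (count-++ a p q)) (sym (+-assoc (δ a b) _ _))

count-All : ∀ {ℓ} {P : Pred (Fin m) ℓ} {a p} → All P p → ¬ P a → count a p ≡ 0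
count-All []                  ¬Pa = refl
count-All {P = P} {a} (_∷_ {b} Pb Pp) ¬Pa =
  cong₂ _+_ (δ-≢ {i = a} {b} (λ { refl → ¬Pa Pb })) (count-All Pp ¬Pa)

count-split : ∀ (a : Fin m) p → 0 < count a p → ∃[ q ] ∃[ t ] p ≡ q ++ a ∷ t
count-split a (b ∷ p) 0<c with a ≟ b
... | yes refl = [] , p , refl
... | no  _ with q , t , refl ← count-split a p 0<c = b ∷ q , t , refl

length-count : (p : List (Fin m)) → length p ≡ sum (λ a → count a p)
length-count {m = m} []  = sym (sum-zero {m} (λ _ → refl))
length-count (b ∷ p) = sym (trans (∑-distrib-+ (λ a → δ a b) (λ a → count a p))
                                  (cong₂ _+_ (sum-δ b) (sym (length-count p))))

module Walks (G : SkewSymmetricGraph n m) where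
  open SkewSymmetricGraph G

  Walk : Fin n → List (Fin m) → Fin n → Set
  Walk v []      w = v ≡ w
  Walk v (a ∷ p) w = src a ≡ v × Walk (tgt a) p w

  walk? : ∀ v p w → Dec (Walk v p w)
  walk? v []      w = v ≟ w
  walk? v (a ∷ p) w = (src a ≟ v) ×-dec walk? (tgt a) p w

  walk-++ : ∀ {v} p {w q z} → Walk v p w → Walk w q z → Walk v (p ++ q) z
  walk-++ []      refl         walk-q = walk-q
  walk-++ (a ∷ p) (refl , walk-p) walk-q = refl , walk-++ p walk-p walk-q

  walk-split : ∀ {v} p {q z} → Walk v (p ++ q) z → ∃[ w ] Walk v p w × Walk w q z
  walk-split []      walk-q        = _ , refl , walk-q
  walk-split (a ∷ p) (refl , walk) with w , walk-p , walk-q ← walk-split p walk =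
    w , (refl , walk-p) , walk-q

  mirror : List (Fin m) → List (Fin m)
  mirror []      = []
  mirror (a ∷ p) = mirror p ++ [ σE a ]

  walk-mirror : ∀ {v} p {w} → Walk v p w → Walk (σV w) (mirror p) (σV v)
  walk-mirror []      refl          = refl
  walk-mirror (a ∷ p) (refl , walk) =
    walk-++ (mirror p) (walk-mirror p walk) (src-σE a , tgt-σE a)

  σV-swap : ∀ {v w} → σV v ≡ w → v ≡ σV w
  σV-swap {v} refl = sym (σV-invol v)

  σE-swap : ∀ {a b} → σE a ≡ b → a ≡ σE b
  σE-swap {a} refl = sym (σE-invol a)

  δ-σ : ∀ a b → δ (σE a) b ≡ δ a (σE b)
  δ-σ a b with a ≟ σE b
  ... | yes refl = trans (cong (λ c → δ c b) (σE-invol b)) (δ-refl b)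
  ... | no  a≢σb = δ-≢ (a≢σb ∘ σE-swap)

  count-mirror : ∀ a p → count a (mirror p) ≡ count (σE a) p
  count-mirror a []      = refl
  count-mirror a (b ∷ p) = begin
    count a (mirror p ++ [ σE b ])        ≡⟨ count-++ a (mirror p) [ σE b ] ⟩
    count a (mirror p) + (δ a (σE b) + 0) ≡⟨ cong₂ _+_ (count-mirror a p) (+-identityʳ _) ⟩
    count (σE a) p + δ a (σE b)           ≡⟨ +-comm (count (σE a) p) _ ⟩
    δ a (σE b) + count (σE a) p           ≡⟨ cong (_+ count (σE a) p) (sym (δ-σ a b)) ⟩
    δ (σE a) b + count (σE a) p           ∎
    where open ≡-Reasoning

  use : Fin m → List (Fin m) → ℕ
  use a p = count a p + count (σE a) p

  use-++ : ∀ a p q → use a (p ++ q) ≡ use a p + use a q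
  use-++ a p q = trans (cong₂ _+_ (count-++ a p q) (count-++ (σE a) p q))
                       (+-interchange (count a p) (count a q) (count (σE a) p) (count (σE a) q))

  use-σ : ∀ a p → use (σE a) p ≡ use a p
  use-σ a p = trans (cong (λ b → count (σE a) p + count b p) (σE-invol a)) (+-comm (count (σE a) p) _)

  use-[σ] : ∀ a b → use a [ σE b ] ≡ use a [ b ]
  use-[σ] a b = begin
    δ a (σE b) + 0 + (δ (σE a) (σE b) + 0)  ≡⟨ cong₂ _+_ (cong (_+ 0) (sym (δ-σ a b)))
                                                (cong (_+ 0) (trans (sym (δ-σ (σE a) b))
                                                                    (cong (λ c → δ c b) (σE-invol a)))) ⟩
    δ (σE a) b + 0 + (δ a b + 0)            ≡⟨ +-comm (δ (σE a) b + 0) _ ⟩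
    δ a b + 0 + (δ (σE a) b + 0)            ∎
    where open ≡-Reasoning

  use-[self] : ∀ a → use a [ a ] ≡ 1
  use-[self] a = cong₂ (λ x y → x + 0 + (y + 0)) (δ-refl a) (δ-≢ (σE-fixfree a))

  use-All : ∀ {ℓ} {P : Pred (Fin m) ℓ} {a p} → All P p → ¬ P a → ¬ P (σE a) → use a p ≡ 0
  use-All Pp ¬Pa ¬Pσa = cong₂ _+_ (count-All Pp ¬Pa) (count-All Pp ¬Pσa)

  use-[]-pos : ∀ a b → 0 < use a [ b ] → a ≡ b ⊎ a ≡ σE b
  use-[]-pos a b 0<use with a ≟ b | a ≟ σE b
  ... | yes a≡b | _        = inj₁ a≡b
  ... | no  _   | yes a≡σb = inj₂ a≡σb
  ... | no  a≢b | no  a≢σb = contradiction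
    (trans (cong (_+ 0) (δ-σ a b)) (cong (_+ 0) (δ-≢ a≢σb))) (n>0⇒n≢0 0<use)

  -- A walk p is regular when it can be pushed together with its mirror image
  -- without exceeding the capacities r.
  Regular : (Fin m → ℕ) → List (Fin m) → Set
  Regular r p = ∀ a → use a p ≤ r a

  regular-++ˡ : ∀ {r} p {q} → Regular r (p ++ q) → Regular r p
  regular-++ˡ p {q} reg a =
    ≤-trans (m≤m+n (use a p) (use a q)) (≤-trans (≤-reflexive (sym (use-++ a p q))) (reg a))

  regular-++ʳ : ∀ {r} p {q} → Regular r (p ++ q) → Regular r q
  regular-++ʳ p {q} reg a =
    ≤-trans (m≤n+m (use a q) (use a p)) (≤-trans (≤-reflexive (sym (use-++ a p q))) (reg a))

  use-symmetric-≤ : ∀ {g r : Fin m → ℕ} → Symmetric g → Symmetric r → (∀ a → g a ≤ r a) →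
                    ∀ e → g e < r e → ∀ a → g a + use a [ e ] ≤ r a
  use-symmetric-≤ {g} {r} g-sym r-sym g≤r e ge<re a with use a [ e ] ≟ℕ 0
  ... | yes use≡0 = ≤-trans (≤-reflexive (trans (cong (g a +_) use≡0) (+-identityʳ (g a)))) (g≤r a)
  ... | no  use≢0 with use-[]-pos a e (n≢0⇒n>0 use≢0)
  ...   | inj₁ refl = ≤-trans (≤-reflexive (trans (cong (g a +_) (use-[self] a)) (+-comm (g a) 1))) ge<re
  ...   | inj₂ refl = subst₂ _≤_ (cong₂ _+_ (sym (g-sym e)) (sym (use-σ e [ e ]))) (sym (r-sym e))
                        (≤-trans (≤-reflexive (trans (cong (g e +_) (use-[self] e)) (+-comm (g e) 1))) ge<re)

  regular-[] : ∀ {r} → Regular r []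
  regular-[] a = z≤n

  regular-single : ∀ {r e} → Symmetric r → 0 < r e → Regular r [ e ]
  regular-single {e = e} r-sym 0<re = use-symmetric-≤ {g = λ _ → 0} (λ _ → refl) r-sym (λ _ → z≤n) e 0<re

  Reach : (Fin m → ℕ) → Fin n → Fin n → Set
  Reach r x v = ∃[ p ] Walk x p v × Regular r p

  -- Abstract, so that the search never unfolds in goals.
  abstract
    reach? : ∀ r x v → Dec (Reach r x v)
    reach? r x v = map′ (λ { (p , _ , walk-reg) → p , walk-reg })
                        (λ { (p , walk , reg) → p , short p reg , walk , reg })
                        (anyList? (sum r) (λ p → walk? x p v ×-dec all? (λ a → use a p ≤?ℕ r a)))
      where
      short : ∀ p → Regular r p → length p ≤ sum r
      short p reg = ≤-trans (≤-reflexive (length-count p))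
                            (sum-mono-≤ (λ a → ≤-trans (m≤m+n (count a p) _) (reg a)))

  reach-refl : ∀ {r x} → Reach r x x
  reach-refl = [] , refl , regular-[]

  reach-prefix : ∀ {r x v p q} → Walk x p v → Regular r (p ++ q) → Reach r x v
  reach-prefix {p = p} walk reg = p , walk , regular-++ˡ p reg

  reach-on : ∀ {r x v} p {a q} → Walk x (p ++ a ∷ q) v → Regular r (p ++ a ∷ q) →
             Reach r x (src a) × Reach r x (tgt a)
  reach-on {r} {x} p {a} {q} walk reg with _ , walk-p , (refl , _) ← walk-split p walk =
    reach-prefix walk-p reg ,
    (p ++ [ a ] , walk-++ p walk-p (refl , refl) ,
      regular-++ˡ (p ++ [ a ]) (subst (Regular r) (sym (++-assoc′ p)) reg))
    where
    ++-assoc′ : ∀ p → (p ++ [ a ]) ++ q ≡ p ++ a ∷ q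
    ++-assoc′ []      = refl
    ++-assoc′ (b ∷ p) = cong (b ∷_) (++-assoc′ p)

  -- A regular walk that cannot be extended by a already uses a or its mate.
  reach-extend : ∀ {r} → Symmetric r → ∀ {x} a → 0 < r a → Reach r x (src a) →
                 Reach r x (tgt a) ⊎ (Reach r x (σV (tgt a)) × Reach r x (σV (src a)))
  reach-extend {r} r-sym {x} a 0<ra (p , walk , reg) with use a p <?ℕ r a
  ... | yes use<r = inj₁ (p ++ [ a ] , walk-++ p walk (refl , refl) , λ b →
          ≤-trans (≤-reflexive (use-++ b p [ a ]))
                  (use-symmetric-≤ (λ b → use-σ b p) r-sym reg a use<r b))
  ... | no  use≮r with count a p ≟ℕ 0 | count (σE a) p ≟ℕ 0
  ...   | no c≢0 | _ with q , t , refl ← count-split a p (n≢0⇒n>0 c≢0) =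
          inj₁ (proj₂ (reach-on q walk reg))
  ...   | yes _  | no c≢0 with q , t , refl ← count-split (σE a) p (n≢0⇒n>0 c≢0) =
          let reach-src , reach-tgt = reach-on q walk reg in
          inj₂ (subst (Reach r x) (src-σE a) reach-src , subst (Reach r x) (tgt-σE a) reach-tgt)
  ...   | yes c≡0 | yes c′≡0 = contradiction (≤-trans 0<ra (≮⇒≥ use≮r))
          (λ 0<use → n>0⇒n≢0 0<use (cong₂ _+_ c≡0 c′≡0))

-- Nodes reached by regular walks, and their components

module _ {C : Pred (Fin n) 0ℓ} (C? : Decidable C) (G : SkewSymmetricGraph n m) where
  open SkewSymmetricGraph G
  open Walks G

  first-entry : ∀ {v} p {w} → Walk v p w → ¬ C v → C w →
                ∃[ q ] ∃[ e ] ∃[ t ] p ≡ q ++ e ∷ t × All (λ a → ¬ C (src a) × ¬ C (tgt a)) q ×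
                Walk v q (src e) × ¬ C (src e) × C (tgt e)
  first-entry []      refl          v∉C w∈C = contradiction w∈C v∉C
  first-entry (a ∷ p) (refl , walk) v∉C w∈C with C? (tgt a)
  ... | yes ta∈C = [] , a , p , refl , [] , refl , v∉C , ta∈C
  ... | no  ta∉C with q , e , t , refl , outside , walk-q , se∉C , te∈C ← first-entry p walk ta∉C w∈C =
    a ∷ q , e , t , refl , (v∉C , ta∉C) ∷ outside , (refl , walk-q) , se∉C , te∈C

  last-entry : ∀ {v} p {w} → Walk v p w → C w →
               (C v × All (λ a → C (src a) × C (tgt a)) p) ⊎
               (∃[ q ] ∃[ e ] ∃[ t ] p ≡ q ++ e ∷ t × All (λ a → C (src a) × C (tgt a)) t ×
                Walk (tgt e) t w × ¬ C (src e) × C (tgt e))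
  last-entry []      refl          w∈C = inj₁ (w∈C , [])
  last-entry (a ∷ p) (refl , walk) w∈C with last-entry p walk w∈C
  ... | inj₂ (q , e , t , refl , rest) = inj₂ (a ∷ q , e , t , refl , rest)
  ... | inj₁ (ta∈C , inside) with C? (src a)
  ...   | yes sa∈C = inj₁ (sa∈C , (sa∈C , ta∈C) ∷ inside)
  ...   | no  sa∉C = inj₂ ([] , a , p , refl , inside , walk , sa∉C , ta∈C)

module Structure (G : SkewSymmetricGraph n m) (r : Fin m → ℕ)
                 (r-sym : SkewSymmetricGraph.Symmetric G r) (x : Fin n) where
  open SkewSymmetricGraph G
  open Walks G

  R A X : Fin n → Set
  R   = Reach r x
  A v = R v × ¬ R (σV v)
  X v = R v × R (σV v)

  R? : Decidable R
  R? = reach? r x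

  A? : Decidable A
  A? v = R? v ×-dec ¬? (R? (σV v))

  X? : Decidable X
  X? v = R? v ×-dec R? (σV v)

  X-σ : ∀ {v} → X v → X (σV v)
  X-σ {v} (Rv , Rσv) = Rσv , subst R (sym (σV-invol v)) Rv

  r-σ : ∀ {a} → 0 < r a → 0 < r (σE a)
  r-σ {a} = subst (0 <_) (sym (r-sym a))

  A-arc : ∀ a → 0 < r a → A (src a) → R (tgt a)
  A-arc a 0<ra (Rsrc , ¬Rσsrc) with reach-extend r-sym a 0<ra Rsrc
  ... | inj₁ Rtgt        = Rtgt
  ... | inj₂ (_ , Rσsrc) = contradiction Rσsrc ¬Rσsrc

  R-arc : ∀ a → 0 < r a → R (src a) → R (tgt a) ⊎ R (σV (tgt a))
  R-arc a 0<ra Rsrc with reach-extend r-sym a 0<ra Rsrc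
  ... | inj₁ Rtgt        = inj₁ Rtgt
  ... | inj₂ (Rσtgt , _) = inj₂ Rσtgt

  Joins : Fin n → Fin n → Fin m → Set
  Joins v w a = (src a ≡ v × tgt a ≡ w) ⊎ (src a ≡ w × tgt a ≡ v)

  Step : Fin n → Fin n → Set
  Step v w = (X v × X w) × (w ≡ σV v ⊎ (∃[ a ] 0 < r a × Joins v w a))

  step? : ∀ v w → Dec (Step v w)
  step? v w = (X? v ×-dec X? w) ×-dec ((w ≟ σV v) ⊎-dec
    any? (λ a → (0 <?ℕ r a) ×-dec
      (((src a ≟ v) ×-dec (tgt a ≟ w)) ⊎-dec ((src a ≟ w) ×-dec (tgt a ≟ v)))))

  step-sym : ∀ {v w} → Step v w → Step w v
  step-sym ((Xv , Xw) , inj₁ w≡σv)              = (Xw , Xv) , inj₁ (σV-swap (sym w≡σv))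
  step-sym ((Xv , Xw) , inj₂ (a , 0<ra , joins)) = (Xw , Xv) , inj₂ (a , 0<ra , swap joins)

  -- Connectedness is the absence of a separating set, because the subsets of Fin n
  -- can be searched exhaustively.
  Separates : Fin n → Fin n → Subset n → Set
  Separates y v S = y ∈ S × v ∉ S × (∀ u w → Step u w → u ∈ S → w ∈ S)

  separates? : ∀ y v → Decidable (Separates y v)
  separates? y v S = (y ∈? S) ×-dec ¬? (v ∈? S) ×-dec
    all? (λ u → all? (λ w → step? u w →-dec (u ∈? S) →-dec (w ∈? S)))

  Conn : Fin n → Fin n → Set
  Conn y v = ¬ (∃ (Separates y v))

  abstract
    conn? : ∀ y → Decidable (Conn y)
    conn? y v = ¬? (anySubset? (separates? y v))

  conn-refl : ∀ {y} → Conn y y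
  conn-refl (S , y∈S , y∉S , _) = y∉S y∈S

  conn-step : ∀ {y v w} → Conn y v → Step v w → Conn y w
  conn-step {v = v} {w} y~v step (S , y∈S , w∉S , closed) =
    y~v (S , y∈S , (λ v∈S → w∉S (closed v w step v∈S)) , closed)

  conn-ind : {P : Fin n → Set} → Decidable P → ∀ {y v} → P y → (∀ {u w} → Step u w → P u → P w) →
             Conn y v → P v
  conn-ind {P} P? {y} {v} Py closed y~v = decidable-stable (P? v) λ ¬Pv → y~v
    (subsetOf P? , ∈-subsetOf⁺ P? Py , ¬Pv ∘ ∈-subsetOf⁻ P? ,
     λ u w step → ∈-subsetOf⁺ P? ∘ closed step ∘ ∈-subsetOf⁻ P?)

  conn-trans : ∀ {y v w} → Conn y v → Conn v w → Conn y w
  conn-trans {y} y~v = conn-ind (conn? y) y~v (λ step y~u → conn-step y~u step)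

  conn-sym : ∀ {y v} → Conn y v → Conn v y
  conn-sym {y} = conn-ind (λ v → conn? v y) conn-refl
    (λ step → conn-trans (conn-step conn-refl (step-sym step)))

  conn-X : ∀ {y v} → X y → Conn y v → X v
  conn-X Xy = conn-ind X? Xy (λ { ((_ , Xw) , _) _ → Xw })

  conn-σ : ∀ {y v} → X y → Conn y v → Conn y (σV v)
  conn-σ Xy y~v = let Xv = conn-X Xy y~v in conn-step y~v ((Xv , X-σ Xv) , inj₁ refl)

  conn-arc : ∀ {y} → X y → ∀ a → 0 < r a → Conn y (src a) → X (tgt a) → Conn y (tgt a)
  conn-arc Xy a 0<ra y~src Xtgt =
    conn-step y~src ((conn-X Xy y~src , Xtgt) , inj₂ (a , 0<ra , inj₁ (refl , refl)))

  conn-arc⁻ : ∀ {y} → X y → ∀ a → 0 < r a → Conn y (tgt a) → X (src a) → Conn y (src a)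
  conn-arc⁻ Xy a 0<ra y~tgt Xsrc =
    conn-step y~tgt ((conn-X Xy y~tgt , Xsrc) , inj₂ (a , 0<ra , inj₂ (refl , refl)))

  Entry : Fin n → Fin m → Set
  Entry y e = 0 < r e × A (src e) × Conn y (tgt e)

  UniqueEntries : Set
  UniqueEntries = ∀ {y e e′} → X y → Entry y e → Entry y e′ → e ≡ e′ × r e ≡ 1

  regular-tail : ∀ a p → Regular r (a ∷ p) → Regular r p
  regular-tail a p reg = regular-++ʳ [ a ] {p} reg

  regular-skip : ∀ a b p → Regular r (a ∷ b ∷ p) → Regular r (a ∷ p)
  regular-skip a b p reg c = ≤-trans
    (+-mono-≤ (+-monoʳ-≤ (δ c a) (m≤n+m (count c p) (δ c b)))
              (+-monoʳ-≤ (δ (σE c) a) (m≤n+m (count (σE c) p) (δ (σE c) b))))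
    (reg c)

  regular-pos : ∀ {a} p → Regular r (a ∷ p) → 0 < r a
  regular-pos {a} p reg = begin
    1                                               ≡⟨ δ-refl a ⟨
    δ a a                                           ≤⟨ m≤m+n (δ a a) (count a p) ⟩
    δ a a + count a p                               ≤⟨ m≤m+n (δ a a + count a p) _ ⟩
    use a (a ∷ p)                                   ≤⟨ reg a ⟩
    r a                                             ∎
    where open ≤-Reasoning

  regular-mate : ∀ {e} p → r e ≡ 1 → Regular r (e ∷ p) → count (σE e) p ≡ 0
  regular-mate {e} p re≡1 reg = n≤0⇒n≡0 (≤-pred (begin
    suc (count (σE e) p)
      ≤⟨ s≤s (m≤n+m (count (σE e) p) (count e p + δ (σE e) e)) ⟩
    suc (count e p + δ (σE e) e + count (σE e) p)
      ≡⟨ cong suc (+-assoc (count e p) _ _) ⟩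
    1 + count e p + (δ (σE e) e + count (σE e) p)
      ≡⟨ cong (λ d → d + count e p + (δ (σE e) e + count (σE e) p)) (δ-refl e) ⟨
    use e (e ∷ p)
      ≤⟨ reg e ⟩
    r e
      ≡⟨ re≡1 ⟩
    1 ∎))
    where open ≤-Reasoning

  module _ (unique : UniqueEntries) where

    A-mate : ∀ b → R (σV (tgt b)) → ¬ R (tgt b) → A (src (σE b))
    A-mate b Rσtgt ¬Rtgt = subst A (sym (src-σE b)) (Rσtgt , ¬Rtgt ∘ subst R (σV-invol (tgt b)))

    -- Nodes v with σ v unreached can be left only towards each other or, through
    -- its unique entry, into a component; the only way from there into σ(A) is the
    -- mate of that entry.
    no-return : ∀ {v z} p → A z → Walk v p (σV z) → Regular r p → ¬ R (σV v) → ⊥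
    no-exit : ∀ {e v z} p → Entry v e → X v → A z → Walk v p (σV z) → Regular r (e ∷ p) → ⊥

    no-return {z = z} []      (Rz , _) refl reg ¬Rσv = ¬Rσv (subst R (sym (σV-invol z)) Rz)
    no-return         (b ∷ p) Az       (refl , walk) reg ¬Rσsrc with R? (σV (tgt b))
    ... | no  ¬Rσtgt = no-return p Az walk (regular-tail b p reg) ¬Rσtgt
    ... | yes Rσtgt with R? (tgt b)
    ...   | no ¬Rtgt = ¬Rσsrc (subst R (tgt-σE b)
              (A-arc (σE b) (r-σ (regular-pos p reg)) (A-mate b Rσtgt ¬Rtgt)))
    ...   | yes Rtgt with R? (src b)
    ...     | yes Rsrc =
              no-exit p (regular-pos p reg , (Rsrc , ¬Rσsrc) , conn-refl) (Rtgt , Rσtgt) Az walk reg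
    ...     | no ¬Rsrc with R-arc (σE b) (r-σ (regular-pos p reg)) (subst R (sym (src-σE b)) Rσtgt)
    ...       | inj₁ Rσsrc  = ¬Rσsrc (subst R (tgt-σE b) Rσsrc)
    ...       | inj₂ Rσσsrc = ¬Rsrc (subst R (trans (cong σV (tgt-σE b)) (σV-invol (src b))) Rσσsrc)

    no-exit []      entry (Rv , _) (_ , ¬Rσz) refl          reg = ¬Rσz Rv
    no-exit {e} (b ∷ p) entry@(0<re , Ae , v~e) Xv Az (refl , walk) reg with R? (σV (tgt b))
    ... | no ¬Rσtgt = no-return p Az walk (regular-tail b p (regular-tail e (b ∷ p) reg)) ¬Rσtgt
    ... | yes Rσtgt with R? (tgt b)
    ...   | yes Rtgt = no-exit p
              (0<re , Ae , conn-trans (conn-sym (conn-arc Xv b 0<rb conn-refl (Rtgt , Rσtgt))) v~e)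
              (Rtgt , Rσtgt) Az walk (regular-skip e b p reg)
      where
      0<rb : 0 < r b
      0<rb = regular-pos p (regular-tail e (b ∷ p) reg)
    ...   | no ¬Rtgt with unique Xv entry exit
      where
      exit : Entry (src b) (σE b)
      exit = r-σ (regular-pos p (regular-tail e (b ∷ p) reg)) , A-mate b Rσtgt ¬Rtgt ,
             subst (Conn (src b)) (sym (tgt-σE b)) (conn-σ Xv conn-refl)
    ...     | refl , re≡1 with () ← trans
      (sym (cong₂ _+_ (trans (cong (λ c → δ c b) (σE-invol b)) (δ-refl b)) refl))
      (regular-mate (b ∷ p) re≡1 reg)

module _ (G : SkewSymmetricGraph n m) where
  open SkewSymmetricGraph G
  open Walks G

  Unique : (r : Fin m → ℕ) → Symmetric r → Fin n → Set
  Unique r r-sym x = Structure.UniqueEntries G r r-sym x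

  module Contract
    (r : Fin m → ℕ) (r-sym : Symmetric r) (x : Fin n) (¬Rσx : ¬ Reach r x (σV x))
    (y : Fin n) (Xy : Structure.X G r r-sym x y)
    (IH : ∀ r̂ → sum r̂ < sum r → (r̂-sym : Symmetric r̂) → ∀ x₀ →
          ¬ Reach r̂ x₀ (σV x₀) → Unique r̂ r̂-sym x₀)
    where
    open Structure G r r-sym x

    C : Fin n → Set
    C = Conn y

    C? : Decidable C
    C? = conn? y

    Inside Touches : Fin m → Set
    Inside a  = C (src a) × C (tgt a)
    Touches a = C (src a) ⊎ C (tgt a)

    abstract
      inside? : Decidable Inside
      inside? a = C? (src a) ×-dec C? (tgt a)

    C-σ⁻ : ∀ {v} → C (σV v) → C v
    C-σ⁻ {v} c = subst C (σV-invol v) (conn-σ Xy c)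

    inside-σ : ∀ {a} → Inside a → Inside (σE a)
    inside-σ {a} (c , d) = subst C (sym (src-σE a)) (conn-σ Xy d) , subst C (sym (tgt-σE a)) (conn-σ Xy c)

    inside-σ⁻ : ∀ {a} → Inside (σE a) → Inside a
    inside-σ⁻ {a} i = subst Inside (σE-invol a) (inside-σ i)

    touches-σ : ∀ {a} → Touches a → Touches (σE a)
    touches-σ {a} (inj₁ c) = inj₂ (subst C (sym (tgt-σE a)) (conn-σ Xy c))
    touches-σ {a} (inj₂ c) = inj₁ (subst C (sym (src-σE a)) (conn-σ Xy c))

    A∉C : ∀ {v} → A v → ¬ C v
    A∉C (_ , ¬Rσv) v∈C = ¬Rσv (proj₂ (conn-X Xy v∈C))

    crossing-entry : ∀ {e} → 0 < r e → R (src e) → ¬ C (src e) → C (tgt e) → Entry y e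
    crossing-entry {e} 0<re Rsrc src∉C tgt∈C =
      0<re , (Rsrc , λ Rσsrc → src∉C (conn-arc⁻ Xy e 0<re tgt∈C (Rsrc , Rσsrc))) , tgt∈C

    split-entry : ∀ q {e t v} → Walk x (q ++ e ∷ t) v → Regular r (q ++ e ∷ t) →
                  ¬ C (src e) → C (tgt e) → Entry y e
    split-entry q {e} {t} walk reg =
      crossing-entry (regular-pos t (regular-++ʳ q reg)) (proj₁ (reach-on q walk reg))

    module _ (p₀ : List (Fin m)) (e₀ : Fin m) (walk₀ : Walk x p₀ (src e₀)) (reg₀ : Regular r p₀)
             (avoid : All (λ a → ¬ C (src a) × ¬ C (tgt a)) p₀) (entry₀ : Entry y e₀) where

      0<re₀ : 0 < r e₀
      0<re₀ = proj₁ entry₀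

      src₀∉C : ¬ C (src e₀)
      src₀∉C = A∉C (proj₁ (proj₂ entry₀))

      tgt₀∈C : C (tgt e₀)
      tgt₀∈C = proj₂ (proj₂ entry₀)

      -- use a [ e₀ ] is 1 on e₀ and its mate and 0 elsewhere.
      r̂ : Fin m → ℕ
      r̂ a = if does (inside? a) then r a else use a [ e₀ ]

      r̂-inside : ∀ {a} → Inside a → r̂ a ≡ r a
      r̂-inside {a} i rewrite dec-true (inside? a) i = refl

      r̂-outside : ∀ {a} → ¬ Inside a → r̂ a ≡ use a [ e₀ ]
      r̂-outside {a} ¬i rewrite dec-false (inside? a) ¬i = refl

      use₀-inside : ∀ {a} → Inside a → use a [ e₀ ] ≡ 0
      use₀-inside i = use-All {P = ¬_ ∘ Inside} ((src₀∉C ∘ proj₁) ∷ []) (λ ¬i → ¬i i) (λ ¬i → ¬i (inside-σ i))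

      r̂-sym : Symmetric r̂
      r̂-sym a with inside? a
      ... | yes i = trans (r̂-inside (inside-σ i)) (r-sym a)
      ... | no ¬i = trans (r̂-outside (¬i ∘ inside-σ⁻)) (use-σ a [ e₀ ])

      r̂≤r : ∀ a → r̂ a ≤ r a
      r̂≤r a with inside? a
      ... | yes _ = ≤-refl
      ... | no  _ = regular-single r-sym 0<re₀ a

      r̂-untouched : ∀ {a} → ¬ Touches a → r̂ a ≡ 0
      r̂-untouched ¬t = trans (r̂-outside (¬t ∘ inj₁ ∘ proj₁))
        (use-All {P = Touches} (inj₂ tgt₀∈C ∷ []) ¬t (¬t ∘ subst Touches (σE-invol _) ∘ touches-σ))

      r̂-e₀ : r̂ e₀ ≡ 1
      r̂-e₀ = trans (r̂-outside (src₀∉C ∘ proj₁)) (use-[self] e₀)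

      regular-inside : ∀ {p} → All Inside p → Regular r p → Regular r̂ p
      regular-inside in-p reg a with inside? a
      ... | yes _ = reg a
      ... | no ¬i = ≤-trans (≤-reflexive (use-All in-p ¬i (¬i ∘ inside-σ⁻))) z≤n

      regular-e₀∷ : ∀ p → All Inside p → Regular r p → Regular r̂ (e₀ ∷ p)
      regular-e₀∷ p in-p reg a = ≤-trans (≤-reflexive (use-++ a [ e₀ ] p)) (bound (inside? a))
        where
        bound : Dec (Inside a) → use a [ e₀ ] + use a p ≤ r̂ a
        bound (yes i) = ≤-trans (≤-reflexive (cong (_+ use a p) (use₀-inside i)))
                                (≤-trans (reg a) (≤-reflexive (sym (r̂-inside i))))
        bound (no ¬i) = ≤-reflexive (trans (cong (use a [ e₀ ] +_) (use-All in-p ¬i (¬i ∘ inside-σ⁻)))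
                                           (trans (+-identityʳ _) (sym (r̂-outside ¬i))))

      open Structure G r̂ r̂-sym (src e₀) using ()
        renaming (R to R̂; R? to R̂?; A to Â; R-arc to R̂-arc; no-return to no-return̂; regular-pos to regular-poŝ;
                  regular-mate to regular-matê)

      arc-r̂ : ∀ {b} → 0 < r̂ b → Inside b ⊎ b ≡ e₀ ⊎ b ≡ σE e₀
      arc-r̂ {b} 0<r̂b with inside? b
      ... | yes i = inj₁ i
      ... | no  _ = inj₂ (use-[]-pos b e₀ 0<r̂b)

      stays : ∀ {v} p {w} → C v → Walk v p w → Regular r̂ p → count (σE e₀) p ≡ 0 → C w
      stays []      v∈C refl          reg _ = v∈C
      stays (b ∷ p) v∈C (refl , walk) reg c≡0 with arc-r̂ (regular-poŝ p reg)
      ... | inj₁ (_ , tb∈C)   = stays p tb∈C walk (regular-++ʳ [ b ] {p} reg) (m+n≡0⇒n≡0 (δ (σE e₀) b) c≡0)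
      ... | inj₂ (inj₁ refl)  = contradiction v∈C src₀∉C
      ... | inj₂ (inj₂ refl) with () ← trans (sym (cong (_+ count b p) (δ-refl b))) c≡0

      R̂-C : ∀ {v} → R̂ v → v ≡ src e₀ ⊎ C v
      R̂-C ([]    , refl          , reg) = inj₁ refl
      R̂-C (b ∷ p , (src≡ , walk) , reg) with arc-r̂ (regular-poŝ p reg)
      ... | inj₁ (sb∈C , _)  = contradiction (subst C src≡ sb∈C) src₀∉C
      ... | inj₂ (inj₁ refl) = inj₂ (stays p tgt₀∈C walk (regular-++ʳ [ b ] {p} reg) (regular-matê p r̂-e₀ reg))
      ... | inj₂ (inj₂ refl) = contradiction
        (subst C (trans (sym (src-σE e₀)) src≡) (conn-σ Xy tgt₀∈C)) src₀∉C

      ¬R̂σ : ¬ R̂ (σV (src e₀))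
      ¬R̂σ R̂σ with R̂-C R̂σ
      ... | inj₁ σ≡  = σV-fixfree _ σ≡
      ... | inj₂ σ∈C = src₀∉C (C-σ⁻ σ∈C)

      module _ {e₁ : Fin m} (entry₁ : Entry y e₁) (extra₁ : r̂ e₁ < r e₁) where

        uniquê : Unique r̂ r̂-sym (src e₀)
        uniquê = IH r̂ (sum-mono-< r̂≤r e₁ extra₁) r̂-sym (src e₀) ¬R̂σ

        exit-blocked : ∀ {e} → Entry y e → r̂ e < r e → ¬ R̂ (σV (tgt e))
        exit-blocked {e} (0<re , (_ , ¬Rσsrc) , tgt∈C) extra (q , walk , reg) = ¬Rσsrc
          (p₀ ++ q ++ [ σE e ] ,
           walk-++ p₀ walk₀ (walk-++ q walk (src-σE e , tgt-σE e)) ,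
           λ a → ≤-trans (≤-reflexive (expand a)) (bound a (touches? a)))
          where
          touches? : Decidable Touches
          touches? a = C? (src a) ⊎-dec C? (tgt a)
          expand : ∀ a → use a (p₀ ++ q ++ [ σE e ]) ≡ use a p₀ + (use a q + use a [ e ])
          expand a = trans (use-++ a p₀ _) (cong (use a p₀ +_) (trans (use-++ a q _) (cong (use a q +_) (use-[σ] a e))))
          bound : ∀ a → Dec (Touches a) → use a p₀ + (use a q + use a [ e ]) ≤ r a
          bound a (yes t) = ≤-trans
            (≤-reflexive (cong (_+ (use a q + use a [ e ]))
              (use-All {P = ¬_ ∘ Touches} (All.map (λ (s , t) → [ s , t ]′) avoid)
                       (λ ¬t → ¬t t) (λ ¬t → ¬t (touches-σ t)))))
            (≤-trans (+-monoˡ-≤ (use a [ e ]) (reg a))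
                     (use-symmetric-≤ r̂-sym r-sym r̂≤r e extra a))
          bound a (no ¬t) = ≤-trans
            (≤-reflexive (trans (cong₂ (λ i j → use a p₀ + (i + j))
               (n≤0⇒n≡0 (≤-trans (reg a) (≤-reflexive (r̂-untouched ¬t))))
               (use-All {P = Touches} (inj₂ tgt∈C ∷ []) ¬t (¬t ∘ subst Touches (σE-invol _) ∘ touches-σ)))
               (+-identityʳ (use a p₀))))
            (reg₀ a)

        -- A regular walk to σ v last enters C through e₀ or through an extra entry.
        R̂-σ : ∀ {v} → C v → R̂ v → R̂ (σV v)
        R̂-σ {v} v∈C R̂v = decidable-stable (R̂? (σV v)) λ ¬R̂σv → go ¬R̂σv (proj₂ (conn-X Xy v∈C))
          where
          go : ¬ R̂ (σV v) → ¬ R (σV v)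
          go ¬R̂σv (p , walk , reg) with last-entry C? G p walk (conn-σ Xy v∈C)
          ... | inj₁ (x∈C , _) = ¬Rσx (proj₂ (conn-X Xy x∈C))
          ... | inj₂ (q , e , t , refl , in-t , walk-t , src∉C , tgt∈C) with r̂ e <?ℕ r e
          ...   | yes extra = exit-blocked entry extra
                    (decidable-stable (R̂? _) (no-return̂ uniquê t (R̂v , ¬R̂σv) walk-t (regular-inside in-t reg-t)))
            where
            entry : Entry y e
            entry = split-entry q walk reg src∉C tgt∈C
            reg-t : Regular r t
            reg-t = regular-++ʳ [ e ] {t} (regular-++ʳ q reg)
          ...   | no r̂e≮re with arc-r̂ (≤-trans (regular-pos t (regular-++ʳ q reg)) (≮⇒≥ r̂e≮re))
          ...     | inj₁ (src∈C , _)  = src∉C src∈C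
          ...     | inj₂ (inj₁ refl) = ¬R̂σv (e ∷ t , (refl , walk-t) ,
                      regular-e₀∷ t in-t (regular-++ʳ [ e ] {t} (regular-++ʳ q reg)))
          ...     | inj₂ (inj₂ refl) = src∉C (subst C (sym (src-σE e₀)) (conn-σ Xy tgt₀∈C))

        C⊆R̂ : ∀ {v} → C v → R̂ v
        C⊆R̂ v∈C = proj₂ (conn-ind (λ v → C? v ×-dec R̂? v)
          (tgt₀∈C , [ e₀ ] , (refl , refl) , regular-e₀∷ [] [] regular-[]) closed
          (conn-trans (conn-sym tgt₀∈C) v∈C))
          where
          forward : ∀ a → 0 < r a → Inside a → R̂ (src a) → R̂ (tgt a)
          forward a 0<ra i@(_ , ta∈C) R̂src with R̂-arc a (subst (0 <_) (sym (r̂-inside i)) 0<ra) R̂src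
          ... | inj₁ R̂tgt  = R̂tgt
          ... | inj₂ R̂σtgt = subst R̂ (σV-invol _) (R̂-σ (conn-σ Xy ta∈C) R̂σtgt)
          closed : ∀ {v w} → Step v w → C v × R̂ v → C w × R̂ w
          closed step (v∈C , R̂v) = conn-step v∈C step , go step (conn-step v∈C step)
            where
            go : ∀ {w} → Step _ w → C w → R̂ w
            go (_ , inj₁ refl) _ = R̂-σ v∈C R̂v
            go (_ , inj₂ (a , 0<ra , inj₁ (refl , refl))) w∈C = forward a 0<ra (v∈C , w∈C) R̂v
            go (_ , inj₂ (a , 0<ra , inj₂ (refl , refl))) w∈C = subst R̂ (σV-invol _) (R̂-σ (conn-σ Xy w∈C)
              (subst R̂ (tgt-σE a) (forward (σE a) (r-σ 0<ra) (inside-σ (w∈C , v∈C))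
                (subst R̂ (sym (src-σE a)) (R̂-σ v∈C R̂v)))))

        no-extra : ⊥
        no-extra = exit-blocked entry₁ extra₁ (C⊆R̂ (conn-σ Xy (proj₂ (proj₂ entry₁))))

      only-e₀ : ∀ {e} → Entry y e → e ≡ e₀ × r e ≡ 1
      only-e₀ {e} entry@(0<re , Asrc , _) with r̂ e <?ℕ r e
      ... | yes extra = ⊥-elim (no-extra entry extra)
      ... | no r̂e≮re with arc-r̂ (≤-trans 0<re (≮⇒≥ r̂e≮re))
      ...   | inj₁ (src∈C , _) = contradiction src∈C (A∉C Asrc)
      ...   | inj₂ (inj₁ refl) = refl , ≤-antisym (≤-trans (≮⇒≥ r̂e≮re) (≤-reflexive r̂-e₀)) 0<re
      ...   | inj₂ (inj₂ refl) = contradiction (subst C (sym (src-σE e₀)) (conn-σ Xy tgt₀∈C)) (A∉C Asrc)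

    ∃-entry : ∃[ e₀ ] (Entry y e₀ × (∀ {e} → Entry y e → e ≡ e₀ × r e ≡ 1))
    ∃-entry with p , walk , reg ← proj₁ Xy
            with q , e , t , refl , avoid , walk-q , src∉C , tgt∈C ←
                   first-entry C? G p walk (λ x∈C → ¬Rσx (proj₂ (conn-X Xy x∈C))) conn-refl =
      e , entry , only-e₀ q e walk-q (regular-++ˡ q reg) avoid entry
      where
      entry : Entry y e
      entry = split-entry q walk reg src∉C tgt∈C

  unique-entries : ∀ r → Acc _<_ (sum r) → (r-sym : Symmetric r) → ∀ x → ¬ Reach r x (σV x) → Unique r r-sym x
  unique-entries r (acc rec) r-sym x ¬Rσx Xy entry entry′
    with e₀ , _ , only ← Contract.∃-entry r r-sym x ¬Rσx _ Xy
                           (λ r̂ r̂<r r̂-sym x₀ ¬R̂ → unique-entries r̂ (rec r̂<r) r̂-sym x₀ ¬R̂) =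
    trans (proj₁ (only entry)) (sym (proj₁ (only entry′))) , proj₂ (only entry)

-- The barrier of a network without a regular walk from s to s′

∈-⋃⁺ : ∀ {k} (X : Fin k → Subset n) i {v} → v ∈ X i → v ∈ ⋃ (tabulate X)
∈-⋃⁺ X zero    v∈ = x∈p∪q⁺ (inj₁ v∈)
∈-⋃⁺ X (suc i) v∈ = x∈p∪q⁺ (inj₂ (∈-⋃⁺ (X ∘ suc) i v∈))

∈-⋃⁻ : ∀ {k} (X : Fin k → Subset n) {v} → v ∈ ⋃ (tabulate X) → ∃[ i ] v ∈ X i
∈-⋃⁻ {k = zero}  X v∈ = contradiction v∈ ∉⊥
∈-⋃⁻ {k = suc k} X v∈ with x∈p∪q⁻ (X zero) _ v∈
... | inj₁ v∈X₀ = zero , v∈X₀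
... | inj₂ v∈⋃ with i , v∈Xᵢ ← ∈-⋃⁻ (X ∘ suc) v∈⋃ = suc i , v∈Xᵢ

enumerate : ∀ {ℓ} {P : Pred (Fin m) ℓ} (P? : Decidable P) →
            ∃[ k ] ∃ λ (ι : Fin k → Fin m) → (∀ {i j} → ι i ≡ ι j → i ≡ j) × (∀ i → P (ι i)) ×
            (∀ {a} → P a → ∃[ i ] ι i ≡ a) × sum (λ a → if does (P? a) then 1 else 0) ≡ k
enumerate {m = zero}  P? = 0 , (λ ()) , (λ { {()} }) , (λ ()) , (λ { {()} }) , refl
enumerate {m = suc m} P? with k , ι , inj , all , onto , eq ← enumerate (P? ∘ suc) | P? zero
... | no ¬P₀ = k , suc ∘ ι , inj ∘ suc-injective , all ,
  (λ { {zero} P₀ → contradiction P₀ ¬P₀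
     ; {suc a} Pa → let i , ιi≡a = onto Pa in i , cong suc ιi≡a }) , eq
... | yes P₀ = suc k , ι′ , inj′ , all′ , onto′ , cong suc eq
  where
  ι′ : Fin (suc k) → Fin (suc m)
  ι′ zero    = zero
  ι′ (suc i) = suc (ι i)
  inj′ : ∀ {i j} → ι′ i ≡ ι′ j → i ≡ j
  inj′ {zero}  {zero}  _  = refl
  inj′ {suc i} {suc j} eq = cong suc (inj (suc-injective eq))
  all′ : ∀ i → _
  all′ zero    = P₀
  all′ (suc i) = all i
  onto′ : ∀ {a} → _ → ∃[ i ] ι′ i ≡ a
  onto′ {zero}  _  = zero , refl
  onto′ {suc a} Pa = let i , ιi≡a = onto Pa in suc i , cong suc ιi≡a

module _ (G : SkewSymmetricGraph n m) where
  open SkewSymmetricGraph G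

  ∈-image⁺ : ∀ {S v} → σV v ∈ S → v ∈ image σV S
  ∈-image⁺ {S} {v} σv∈S =
    ∈-subsetOf⁺ (λ v → any? (λ w → (w ∈? S) ×-dec (σV w ≟ v))) (σV v , σv∈S , σV-invol v)

  ∈-image⁻ : ∀ {S v} → v ∈ image σV S → σV v ∈ S
  ∈-image⁻ {S} {v} v∈ with ∈-subsetOf⁻ (λ v → any? (λ w → (w ∈? S) ×-dec (σV w ≟ v))) v∈
  ... | w , w∈S , refl = subst (_∈ S) (sym (σV-invol w)) w∈S

module Barrier (N : SkewSymmetricNetwork n m)
               (¬reach : ¬ Walks.Reach (SkewSymmetricNetwork.graph N) (SkewSymmetricNetwork.u N)
                                       (SkewSymmetricNetwork.s N) (SkewSymmetricNetwork.s′ N)) where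
  open SkewSymmetricNetwork N
  open Walks graph
  open Structure graph u u-symmetric s

  unique : UniqueEntries
  unique = unique-entries graph u (<-wellFounded (sum u)) u-symmetric s ¬reach

  Into : Fin m → Set
  Into e = 0 < u e × A (src e) × X (tgt e)

  into? : Decidable Into
  into? e = (0 <?ℕ u e) ×-dec A? (src e) ×-dec X? (tgt e)

  entry-into : ∀ {e} → Into e → Entry (tgt e) e
  entry-into (0<ue , Asrc , _) = 0<ue , Asrc , conn-refl

  𝐀 : Subset n
  𝐀 = subsetOf A?

  A-σ : ∀ {v} → R (σV v) → ¬ R v → A (σV v)
  A-σ Rσv ¬Rv = Rσv , ¬Rv ∘ subst R (σV-invol _)

  R-cases : ∀ {v} → R v ⊎ R (σV v) → A v ⊎ A (σV v) ⊎ X v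
  R-cases {v} (inj₁ Rv) with R? (σV v)
  ... | yes Rσv = inj₂ (inj₂ (Rv , Rσv))
  ... | no ¬Rσv = inj₁ (Rv , ¬Rσv)
  R-cases {v} (inj₂ Rσv) with R? v
  ... | yes Rv = inj₂ (inj₂ (Rv , Rσv))
  ... | no ¬Rv = inj₂ (inj₁ (A-σ Rσv ¬Rv))

  X-arc : ∀ a → 0 < u a → X (src a) → A (tgt a) ⊎ A (σV (tgt a)) ⊎ X (tgt a)
  X-arc a 0<ua (Rsrc , _) = R-cases (R-arc a 0<ua Rsrc)

  X-arc⁻ : ∀ a → 0 < u a → X (tgt a) → A (src a) ⊎ A (σV (src a)) ⊎ X (src a)
  X-arc⁻ a 0<ua (_ , Rσtgt) = R-cases (flip′ (R-arc (σE a) (r-σ 0<ua) (subst R (sym (src-σE a)) Rσtgt)))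
    where
    flip′ : R (tgt (σE a)) ⊎ R (σV (tgt (σE a))) → R (src a) ⊎ R (σV (src a))
    flip′ (inj₁ R₁) = inj₂ (subst R (tgt-σE a) R₁)
    flip′ (inj₂ R₂) = inj₁ (subst R (trans (cong σV (tgt-σE a)) (σV-invol (src a))) R₂)

  tight-barrier : ∃ λ (B : OddBarrier N) →
                  capacityBetween N (OddBarrier.A B) (∁ (OddBarrier.A B)) ≡ OddBarrier.k B
  tight-barrier with k , ι , ι-inj , ι-into , ι-onto , ι-count ← enumerate into? = B , cap
    where
    𝐗 : Fin k → Subset n
    𝐗 i = subsetOf (conn? (tgt (ι i)))

    X-ι : ∀ i → X (tgt (ι i))
    X-ι i = proj₂ (proj₂ (ι-into i))

    conn-𝐗 : ∀ i {v} → v ∈ 𝐗 i → Conn (tgt (ι i)) v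
    conn-𝐗 i = ∈-subsetOf⁻ (conn? (tgt (ι i)))

    𝐗-conn : ∀ i {v} → Conn (tgt (ι i)) v → v ∈ 𝐗 i
    𝐗-conn i = ∈-subsetOf⁺ (conn? (tgt (ι i)))

    X-𝐗 : ∀ i {v} → v ∈ 𝐗 i → X v
    X-𝐗 i v∈ = conn-X (X-ι i) (conn-𝐗 i v∈)

    A-𝐀 : ∀ {v} → v ∈ 𝐀 → A v
    A-𝐀 = ∈-subsetOf⁻ A?

    𝐗-unique : ∀ i j {v} → v ∈ 𝐗 i → v ∈ 𝐗 j → i ≡ j
    𝐗-unique i j v∈i v∈j = ι-inj (proj₁ (unique (X-ι i) (entry-into (ι-into i))
      (proj₁ (ι-into j) , proj₁ (proj₂ (ι-into j)) , conn-trans (conn-𝐗 i v∈i) (conn-sym (conn-𝐗 j v∈j)))))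

    arc-𝐗 : ∀ i a → 0 < u a → src a ∈ 𝐗 i → X (tgt a) → tgt a ∈ 𝐗 i
    arc-𝐗 i a 0<ua src∈ Xtgt = 𝐗-conn i (conn-arc (X-ι i) a 0<ua (conn-𝐗 i src∈) Xtgt)

    arc-𝐗⁻ : ∀ i a → 0 < u a → tgt a ∈ 𝐗 i → X (src a) → src a ∈ 𝐗 i
    arc-𝐗⁻ i a 0<ua tgt∈ Xsrc = 𝐗-conn i (conn-arc⁻ (X-ι i) a 0<ua (conn-𝐗 i tgt∈) Xsrc)

    𝐌 : Subset n
    𝐌 = ∁ (𝐀 ∪ image σV 𝐀 ∪ ⋃ (tabulate 𝐗))

    𝐌-outside : ∀ i {v} → v ∈ 𝐌 → A v ⊎ A (σV v) ⊎ v ∈ 𝐗 i → ⊥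
    𝐌-outside i v∈M cases = x∈∁p⇒x∉p v∈M (go cases)
      where
      go : _ → _
      go (inj₁ Av)         = x∈p∪q⁺ (inj₁ (∈-subsetOf⁺ A? Av))
      go (inj₂ (inj₁ Aσv)) = x∈p∪q⁺ (inj₂ (x∈p∪q⁺ (inj₁ (∈-image⁺ graph (∈-subsetOf⁺ A? Aσv)))))
      go (inj₂ (inj₂ v∈X)) = x∈p∪q⁺ (inj₂ (x∈p∪q⁺ (inj₂ (∈-⋃⁺ 𝐗 i v∈X))))

    map-inj₂₂ : ∀ {P Q S T : Set} → (S → T) → P ⊎ Q ⊎ S → P ⊎ Q ⊎ T
    map-inj₂₂ f = map₂ (map₂ f)

    entering : ∀ i {a} → 0 < u a → src a ∈ 𝐀 → tgt a ∈ 𝐗 i → ι i ≡ a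
    entering i 0<ua src∈ tgt∈ =
      proj₁ (unique (X-ι i) (entry-into (ι-into i)) (0<ua , A-𝐀 src∈ , conn-𝐗 i tgt∈))

    A-X≡1 : ∀ i → capacityBetween N 𝐀 (𝐗 i) ≡ 1
    A-X≡1 i = trans (sum-single (ι i) (λ a a≢ → off a a≢ (between? a))) on
      where
      between? : Decidable (λ a → src a ∈ 𝐀 × tgt a ∈ 𝐗 i)
      between? a = (src a ∈? 𝐀) ×-dec (tgt a ∈? 𝐗 i)
      off : ∀ a → a ≢ ι i → (d : Dec (src a ∈ 𝐀 × tgt a ∈ 𝐗 i)) → (if does d then u a else 0) ≡ 0
      off a a≢ (no _) = refl
      off a a≢ (yes (src∈ , tgt∈)) with u a ≟ℕ 0
      ... | yes ua≡0 = ua≡0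
      ... | no ua≢0 = contradiction (sym (entering i (n≢0⇒n>0 ua≢0) src∈ tgt∈)) a≢
      on : (if does (between? (ι i)) then u (ι i) else 0) ≡ 1
      on = trans (if-yes (between? (ι i)) (∈-subsetOf⁺ A? (proj₁ (proj₂ (ι-into i))) , 𝐗-conn i conn-refl))
                 (proj₂ (unique (X-ι i) (entry-into (ι-into i)) (entry-into (ι-into i))))

    B : OddBarrier N
    B = record
      { k             = k
      ; A             = 𝐀
      ; X             = 𝐗
      ; A-X-disjoint  = λ i (v , v∈) → let v∈A , v∈X = x∈p∩q⁻ 𝐀 (𝐗 i) v∈ in
                          proj₂ (A-𝐀 v∈A) (proj₂ (X-𝐗 i v∈X))
      ; X-X-disjoint  = λ i j i≢j (v , v∈) → let v∈i , v∈j = x∈p∩q⁻ (𝐗 i) (𝐗 j) v∈ in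
                          i≢j (𝐗-unique i j v∈i v∈j)
      ; s∈A           = ∈-subsetOf⁺ A? (reach-refl , ¬reach)
      ; A-σA-disjoint = λ (v , v∈) → let v∈A , v∈σA = x∈p∩q⁻ 𝐀 (image σV 𝐀) v∈ in
                          proj₂ (A-𝐀 v∈A) (proj₁ (A-𝐀 (∈-image⁻ graph v∈σA)))
      ; X-σ-invariant = λ i → ⊆-antisym
          (λ v∈ → 𝐗-conn i (subst (Conn _) (σV-invol _) (conn-σ (X-ι i) (conn-𝐗 i (∈-image⁻ graph v∈)))))
          (λ v∈ → ∈-image⁺ graph (𝐗-conn i (conn-σ (X-ι i) (conn-𝐗 i v∈))))
      ; A-X-odd       = λ i → cong (_% 2) (A-X≡1 i)
      ; X-X-noArc     = λ where
          i j i≢j (a , 0<ua , inj₁ (src∈ , tgt∈)) → i≢j (𝐗-unique i j (arc-𝐗 i a 0<ua src∈ (X-𝐗 j tgt∈)) tgt∈)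
          i j i≢j (a , 0<ua , inj₂ (src∈ , tgt∈)) → i≢j (𝐗-unique i j (arc-𝐗⁻ i a 0<ua tgt∈ (X-𝐗 j src∈)) src∈)
      ; X-M-noArc     = λ where
          i (a , 0<ua , inj₁ (src∈ , tgt∈)) →
            𝐌-outside i tgt∈ (map-inj₂₂ (arc-𝐗 i a 0<ua src∈) (X-arc a 0<ua (X-𝐗 i src∈)))
          i (a , 0<ua , inj₂ (src∈ , tgt∈)) →
            𝐌-outside i src∈ (map-inj₂₂ (arc-𝐗⁻ i a 0<ua tgt∈) (X-arc⁻ a 0<ua (X-𝐗 i tgt∈)))
      }

    cap : capacityBetween N 𝐀 (∁ 𝐀) ≡ k
    cap = trans (sum-cong-≗ (λ a → pointwise a (leaving? a) (into? a))) ι-count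
      where
      leaving? : Decidable (λ a → src a ∈ 𝐀 × tgt a ∈ ∁ 𝐀)
      leaving? a = (src a ∈? 𝐀) ×-dec (tgt a ∈? ∁ 𝐀)
      leaving-into : ∀ {a} → 0 < u a → src a ∈ 𝐀 → tgt a ∈ ∁ 𝐀 → Into a
      leaving-into {a} 0<ua src∈ tgt∈ with Rtgt ← A-arc a 0<ua (A-𝐀 src∈) | R? (σV (tgt a))
      ... | yes Rσtgt = 0<ua , A-𝐀 src∈ , Rtgt , Rσtgt
      ... | no ¬Rσtgt = contradiction (∈-subsetOf⁺ A? (Rtgt , ¬Rσtgt)) (x∈∁p⇒x∉p tgt∈)
      pointwise : ∀ a (d : Dec (src a ∈ 𝐀 × tgt a ∈ ∁ 𝐀)) (d′ : Dec (Into a)) →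
                  (if does d then u a else 0) ≡ (if does d′ then 1 else 0)
      pointwise a (yes _) (yes into) = proj₂ (unique (proj₂ (proj₂ into)) (entry-into into) (entry-into into))
      pointwise a (no ¬leaving) (yes (_ , Asrc , Xtgt)) = contradiction
        (∈-subsetOf⁺ A? Asrc , x∉p⇒x∈∁p (λ tgt∈ → proj₂ (A-𝐀 tgt∈) (proj₂ Xtgt))) ¬leaving
      pointwise a (no _) (no _) = refl
      pointwise a (yes (src∈ , tgt∈)) (no ¬into) with u a ≟ℕ 0
      ... | yes ua≡0 = ua≡0
      ... | no ua≢0 = contradiction (leaving-into (n≢0⇒n>0 ua≢0) src∈ tgt∈) ¬into

-- Cuts and parity

⟦_⟧ : Bool → ℕ
⟦ b ⟧ = if b then 1 else 0

if-⟦⟧ : ∀ b x → (if b then x else 0) ≡ ⟦ b ⟧ * x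
if-⟦⟧ true  x = sym (+-identityʳ x)
if-⟦⟧ false x = refl

⟦∧⟧ : ∀ b c → ⟦ b ∧ c ⟧ ≡ ⟦ b ⟧ * ⟦ c ⟧
⟦∧⟧ true  c = sym (+-identityʳ ⟦ c ⟧)
⟦∧⟧ false c = refl

χ : Subset n → Fin n → ℕ
χ S v = ⟦ does (v ∈? S) ⟧

χ-∈ : ∀ {S : Subset n} {v} → v ∈ S → χ S v ≡ 1
χ-∈ {S = S} {v} = if-yes (v ∈? S)

χ-∉ : ∀ {S : Subset n} {v} → v ∉ S → χ S v ≡ 0
χ-∉ {S = S} {v} = if-no (v ∈? S)

χ-∁ : ∀ (S : Subset n) v → χ S v + χ (∁ S) v ≡ 1
χ-∁ S v with v ∈? S
... | yes v∈S = cong suc (χ-∉ (λ v∈∁S → x∈∁p⇒x∉p v∈∁S v∈S))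
... | no  v∉S = χ-∈ (x∉p⇒x∈∁p v∉S)

between : (φ ψ : Fin m → Fin n) → Subset n → Subset n → (Fin m → ℕ) → ℕ
between φ ψ S T = sumOver (λ a → (φ a ∈? S) ×-dec (ψ a ∈? T))

between-χ : ∀ (φ ψ : Fin m → Fin n) S T g →
            between φ ψ S T g ≡ sum (λ a → χ S (φ a) * χ T (ψ a) * g a)
between-χ φ ψ S T g = sum-cong-≗ λ a →
  trans (if-⟦⟧ (does (φ a ∈? S) ∧ does (ψ a ∈? T)) (g a))
        (cong (_* g a) (⟦∧⟧ (does (φ a ∈? S)) (does (ψ a ∈? T))))

between-+ : ∀ (φ ψ : Fin m → Fin n) S T {g h k} → (∀ a → g a + h a ≡ k a) →
            between φ ψ S T g + between φ ψ S T h ≡ between φ ψ S T k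
between-+ φ ψ S T {g} {h} {k} g+h≡k = begin
  between φ ψ S T g + between φ ψ S T h
    ≡⟨ cong₂ _+_ (between-χ φ ψ S T g) (between-χ φ ψ S T h) ⟩
  sum (λ a → c a * g a) + sum (λ a → c a * h a)
    ≡⟨ ∑-distrib-+ (λ a → c a * g a) (λ a → c a * h a) ⟨
  sum (λ a → c a * g a + c a * h a)
    ≡⟨ sum-cong-≗ (λ a → trans (sym (*-distribˡ-+ (c a) (g a) (h a))) (cong (c a *_) (g+h≡k a))) ⟩
  sum (λ a → c a * k a)
    ≡⟨ between-χ φ ψ S T k ⟨
  between φ ψ S T k ∎
  where
  open ≡-Reasoning
  c : Fin _ → ℕ
  c a = χ S (φ a) * χ T (ψ a)

between-sym : ∀ (φ ψ : Fin m → Fin n) S T g → between φ ψ S T g ≡ between ψ φ T S g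
between-sym φ ψ S T g = trans (between-χ φ ψ S T g) (trans
  (sum-cong-≗ (λ a → cong (_* g a) (*-comm (χ S (φ a)) (χ T (ψ a)))))
  (sym (between-χ ψ φ T S g)))

sum-χ-split : ∀ (φ ψ : Fin m → Fin n) S g →
              sum (λ a → χ S (φ a) * g a) ≡ between φ ψ S S g + between φ ψ S (∁ S) g
sum-χ-split φ ψ S g = begin
  sum (λ a → χ S (φ a) * g a)
    ≡⟨ sum-cong-≗ split ⟩
  sum (λ a → χ S (φ a) * χ S (ψ a) * g a + χ S (φ a) * χ (∁ S) (ψ a) * g a)
    ≡⟨ ∑-distrib-+ (λ a → χ S (φ a) * χ S (ψ a) * g a) (λ a → χ S (φ a) * χ (∁ S) (ψ a) * g a) ⟩
  sum (λ a → χ S (φ a) * χ S (ψ a) * g a) + sum (λ a → χ S (φ a) * χ (∁ S) (ψ a) * g a)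
    ≡⟨ cong₂ _+_ (between-χ φ ψ S S g) (between-χ φ ψ S (∁ S) g) ⟨
  between φ ψ S S g + between φ ψ S (∁ S) g ∎
  where
  open ≡-Reasoning
  factor : ∀ x y z w → x * y * w + x * z * w ≡ x * (y + z) * w
  factor = solve-∀
  split : ∀ a → χ S (φ a) * g a ≡ χ S (φ a) * χ S (ψ a) * g a + χ S (φ a) * χ (∁ S) (ψ a) * g a
  split a = sym (trans (factor (χ S (φ a)) (χ S (ψ a)) (χ (∁ S) (ψ a)) (g a))
    (cong (_* g a) (trans (cong (χ S (φ a) *_) (χ-∁ S (ψ a))) (*-identityʳ (χ S (φ a))))))

sum-≥1 : ∀ {k} {g : Fin k → ℕ} → (∀ i → 1 ≤ g i) → k ≤ sum g
sum-≥1 {zero}  g≥1 = z≤n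
sum-≥1 {suc k} g≥1 = +-mono-≤ (g≥1 zero) (sum-≥1 (g≥1 ∘ suc))

odd⇒≥1 : ∀ x → x % 2 ≡ 1 → 1 ≤ x
odd⇒≥1 (suc x) _ = s≤s z≤n

module _ (N : SkewSymmetricNetwork n m) (B : OddBarrier N) where
  open SkewSymmetricNetwork N
  open OddBarrier B

  s′∉A : s′ ∉ A
  s′∉A s′∈A = A-σA-disjoint (s , x∈p∩q⁺ (s∈A , ∈-image⁺ graph s′∈A))

  k≤capacity : k ≤ capacityBetween N A (∁ A)
  k≤capacity = begin
    k
      ≤⟨ sum-≥1 (λ i → odd⇒≥1 _ (A-X-odd i)) ⟩
    sum (λ i → sum (λ a → term i a))
      ≡⟨ ∑-comm term ⟩
    sum (λ a → sum (λ i → term i a))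
      ≤⟨ sum-mono-≤ (λ a → bound a (any? (λ i → (src a ∈? A) ×-dec (tgt a ∈? X i)))) ⟩
    capacityBetween N A (∁ A) ∎
    where
    open ≤-Reasoning
    term : Fin k → Fin _ → ℕ
    term i a = if does ((src a ∈? A) ×-dec (tgt a ∈? X i)) then u a else 0
    bound : ∀ a → Dec (∃[ i ] (src a ∈ A × tgt a ∈ X i)) →
            sum (λ i → term i a) ≤ (if does ((src a ∈? A) ×-dec (tgt a ∈? ∁ A)) then u a else 0)
    bound a (no ¬∃) = ≤-trans
      (≤-reflexive (sum-zero (λ i → if-no ((src a ∈? A) ×-dec (tgt a ∈? X i)) (λ in-i → ¬∃ (i , in-i))))) z≤n
    bound a (yes (i , src∈A , tgt∈X)) = ≤-reflexive (begin-equality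
      sum (λ i → term i a)
        ≡⟨ sum-single i (λ j j≢i → if-no ((src a ∈? A) ×-dec (tgt a ∈? X j))
             (λ (_ , tgt∈Xⱼ) → X-X-disjoint j i j≢i (tgt a , x∈p∩q⁺ (tgt∈Xⱼ , tgt∈X)))) ⟩
      term i a
        ≡⟨ if-yes ((src a ∈? A) ×-dec (tgt a ∈? X i)) (src∈A , tgt∈X) ⟩
      u a
        ≡⟨ if-yes ((src a ∈? A) ×-dec (tgt a ∈? ∁ A))
             (src∈A , x∉p⇒x∈∁p (λ tgt∈A → A-X-disjoint i (tgt a , x∈p∩q⁺ (tgt∈A , tgt∈X)))) ⟨
      (if does ((src a ∈? A) ×-dec (tgt a ∈? ∁ A)) then u a else 0) ∎)

module Flow (N : SkewSymmetricNetwork n m) (F : ISFlow N) where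
  open SkewSymmetricNetwork N
  open ISFlow F

  out-s in-s : ℕ
  out-s = outflow N f s
  in-s  = inflow N f s

  balance : ∀ (c : Fin n → ℕ) → c s′ ≡ 0 →
            sum (λ a → c (src a) * f a) + c s * in-s ≡ sum (λ a → c (tgt a) * f a) + c s * out-s
  balance c cs′≡0 = begin
    sum (λ a → c (src a) * f a) + c s * in-s
      ≡⟨ collect src in-s ⟨
    sum (λ v → c v * outflow N f v + c s * in-s * δ v s)
      ≡⟨ sum-cong-≗ pointwise ⟩
    sum (λ v → c v * inflow N f v + c s * out-s * δ v s)
      ≡⟨ collect tgt out-s ⟩
    sum (λ a → c (tgt a) * f a) + c s * out-s ∎
    where
    open ≡-Reasoning
    collect : ∀ (φ : Fin m → Fin n) x →
              sum (λ v → c v * sumOver (λ a → φ a ≟ v) f + c s * x * δ v s) ≡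
              sum (λ a → c (φ a) * f a) + c s * x
    collect φ x = trans
      (∑-distrib-+ (λ v → c v * sumOver (λ a → φ a ≟ v) f) (λ v → c s * x * δ v s))
      (cong₂ _+_ (sum-fibres c φ f)
        (trans (sum-*ˡ (c s * x) (λ v → δ v s)) (trans (cong (c s * x *_) (sum-δ s)) (*-identityʳ (c s * x)))))
    swap-at-s : ∀ k x y → k * x + k * y * 1 ≡ k * y + k * x * 1
    swap-at-s = solve-∀
    pointwise : ∀ v → c v * outflow N f v + c s * in-s * δ v s ≡ c v * inflow N f v + c s * out-s * δ v s
    pointwise v with v ≟ s | v ≟ s′
    ... | yes refl | _        = swap-at-s (c v) out-s in-s
    ... | no  _    | yes refl rewrite cs′≡0 = trans (*-zeroʳ (c s * in-s)) (sym (*-zeroʳ (c s * out-s)))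
    ... | no  v≢s  | no v≢s′  = cong₂ _+_ (cong (c v *_) (conservation v v≢s v≢s′))
                                          (trans (*-zeroʳ (c s * in-s)) (sym (*-zeroʳ (c s * out-s))))

  leaving entering : Subset n → Subset n → ℕ
  leaving  S T = between src tgt S T f
  entering S T = between tgt src S T f

  cut-balance : ∀ S → s ∈ S → s′ ∉ S → leaving S (∁ S) + in-s ≡ entering S (∁ S) + out-s
  cut-balance S s∈S s′∉S = +-cancelˡ-≡ (leaving S S) _ _ (begin
    leaving S S + (leaving S (∁ S) + in-s)
      ≡⟨ +-assoc (leaving S S) _ _ ⟨
    leaving S S + leaving S (∁ S) + in-s
      ≡⟨ cong₂ _+_ (sum-χ-split src tgt S f) (χs* in-s) ⟨
    sum (λ a → χ S (src a) * f a) + χ S s * in-s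
      ≡⟨ balance (χ S) (χ-∉ s′∉S) ⟩
    sum (λ a → χ S (tgt a) * f a) + χ S s * out-s
      ≡⟨ cong₂ _+_ (sum-χ-split tgt src S f) (χs* out-s) ⟩
    entering S S + entering S (∁ S) + out-s
      ≡⟨ cong (λ x → x + entering S (∁ S) + out-s) (between-sym tgt src S S f) ⟩
    leaving S S + entering S (∁ S) + out-s
      ≡⟨ +-assoc (leaving S S) _ _ ⟩
    leaving S S + (entering S (∁ S) + out-s) ∎)
    where
    open ≡-Reasoning
    χs* : ∀ x → χ S s * x ≡ x
    χs* x = trans (cong (_* x) (χ-∈ s∈S)) (+-identityʳ x)

  module Parity (S T : Subset n) (T-σ : ∀ {v} → v ∈ T → σV v ∈ T)
                (s∉T : s ∉ T) (s′∉T : s′ ∉ T)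
                (class : ∀ v → v ∈ T → v ∉ S × σV v ∉ S)
                (S-σ : ∀ v → v ∈ S → σV v ∉ S)
                (from-T : ∀ a → 0 < f a → src a ∈ T → tgt a ∈ S ⊎ σV (tgt a) ∈ S ⊎ tgt a ∈ T)
    where

    χT-σ : ∀ v → χ T (σV v) ≡ χ T v
    χT-σ v with v ∈? T
    ... | yes v∈T = χ-∈ (T-σ v∈T)
    ... | no  v∉T = χ-∉ (λ σv∈T → v∉T (subst (_∈ T) (σV-invol v) (T-σ σv∈T)))

    half : Fin n → ℕ
    half v = if does (v <? σV v) then χ T v else 0

    half-σ : ∀ v → half v + half (σV v) ≡ χ T v
    half-σ v rewrite σV-invol v with <-cmp v (σV v)
    ... | tri< v<σv _ σv≮v rewrite dec-true (v <? σV v) v<σv | dec-false (σV v <? v) σv≮v = +-identityʳ _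
    ... | tri≈ _ v≡σv _ = contradiction (sym v≡σv) (σV-fixfree v)
    ... | tri> v≮σv _ σv<v rewrite dec-false (v <? σV v) v≮σv | dec-true (σV v <? v) σv<v = χT-σ v

    half-∉ : ∀ {v} → v ∉ T → half v ≡ 0
    half-∉ {v} v∉T with does (v <? σV v)
    ... | true  = χ-∉ v∉T
    ... | false = refl

    K : ℕ
    K = sum (λ a → half (src a) * f a)

    K-tgt : sum (λ a → half (tgt a) * f a) ≡ K
    K-tgt = +-cancelʳ-≡ _ _ _ (sym (trans (balance half (half-∉ s′∉T))
      (cong (λ h → sum (λ a → half (tgt a) * f a) + h)
            (trans (cong (_* out-s) (half-∉ s∉T)) (sym (cong (_* in-s) (half-∉ s∉T)))))))

    -- How many of the disjoint sets S, σ(S) and T contain v.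
    ρ : Fin n → ℕ
    ρ v = χ S v + χ S (σV v) + χ T v

    ρ≡1 : ∀ {v} → v ∈ S ⊎ σV v ∈ S ⊎ v ∈ T → ρ v ≡ 1
    ρ≡1 {v} (inj₁ v∈S) = cong₂ _+_ (cong₂ _+_ (χ-∈ v∈S) (χ-∉ (S-σ v v∈S))) (χ-∉ (λ v∈T → proj₁ (class v v∈T) v∈S))
    ρ≡1 {v} (inj₂ (inj₁ σv∈S)) = cong₂ _+_
      (cong₂ _+_ (χ-∉ (λ v∈S → S-σ v v∈S σv∈S)) (χ-∈ σv∈S)) (χ-∉ (λ v∈T → proj₂ (class v v∈T) σv∈S))
    ρ≡1 {v} (inj₂ (inj₂ v∈T)) = cong₂ _+_
      (cong₂ _+_ (χ-∉ (proj₁ (class v v∈T))) (χ-∉ (proj₂ (class v v∈T)))) (χ-∈ v∈T)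

    ρ-tgt : ∀ a → χ T (src a) * ρ (tgt a) * f a ≡ χ T (src a) * f a
    ρ-tgt a with src a ∈? T | f a ≟ℕ 0
    ... | no _      | _        = refl
    ... | yes _     | yes fa≡0 rewrite fa≡0 = *-zeroʳ (1 * ρ (tgt a))
    ... | yes src∈T | no fa≢0  rewrite ρ≡1 {tgt a} (from-T a (n≢0⇒n>0 fa≢0) src∈T) = refl

    ρ-src : ∀ a → χ T (tgt a) * ρ (src a) * f a ≡ χ T (tgt a) * f a
    ρ-src a = begin
      χ T (tgt a) * ρ (src a) * f a
        ≡⟨ cong₂ (λ x y → x * y * f a) (χT-σ (tgt a)) (ρ-σ (src a)) ⟨
      χ T (σV (tgt a)) * ρ (σV (src a)) * f a
        ≡⟨ cong₂ _*_ (cong₂ (λ v w → χ T v * ρ w) (src-σE a) (tgt-σE a)) (symmetric a) ⟨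
      χ T (src (σE a)) * ρ (tgt (σE a)) * f (σE a)
        ≡⟨ ρ-tgt (σE a) ⟩
      χ T (src (σE a)) * f (σE a)
        ≡⟨ cong₂ _*_ (cong (χ T) (src-σE a)) (symmetric a) ⟩
      χ T (σV (tgt a)) * f a
        ≡⟨ cong (_* f a) (χT-σ (tgt a)) ⟩
      χ T (tgt a) * f a ∎
      where
      open ≡-Reasoning
      ρ-σ : ∀ v → ρ (σV v) ≡ ρ v
      ρ-σ v rewrite σV-invol v | χT-σ v = cong (_+ χ T v) (+-comm (χ S (σV v)) (χ S v))

    W D Q : Fin m → ℕ
    W a = half (src a) * f a + half (tgt a) * f a
    D a = χ S (src a) * χ T (tgt a) * f a + χ S (tgt a) * χ T (src a) * f a
    Q a = χ T (src a) * χ T (tgt a) * f a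

    W-pair : ∀ a → W a + W (σE a) ≡ χ T (src a) * f a + χ T (tgt a) * f a
    W-pair a rewrite src-σE a | tgt-σE a | symmetric a = begin
      half (src a) * f a + half (tgt a) * f a + (half (σV (tgt a)) * f a + half (σV (src a)) * f a)
        ≡⟨ regroup (half (src a)) (half (tgt a)) (half (σV (tgt a))) (half (σV (src a))) (f a) ⟩
      (half (src a) + half (σV (src a))) * f a + (half (tgt a) + half (σV (tgt a))) * f a
        ≡⟨ cong₂ (λ x y → x * f a + y * f a) (half-σ (src a)) (half-σ (tgt a)) ⟩
      χ T (src a) * f a + χ T (tgt a) * f a ∎
      where
      open ≡-Reasoning
      regroup : ∀ x y z w k → x * k + y * k + (z * k + w * k) ≡ (x + w) * k + (y + z) * k
      regroup = solve-∀

    D-pair : ∀ a → W a + W (σE a) ≡ (D a + D (σE a)) + (Q a + Q (σE a))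
    D-pair a = trans (W-pair a) (trans (sym (cong₂ _+_ (ρ-tgt a) (ρ-src a))) (sym expand))
      where
      regroup : ∀ a a′ x b b′ y k →
        (a * y * k + b * x * k + (b′ * x * k + a′ * y * k)) + (x * y * k + y * x * k) ≡
        x * (b + b′ + y) * k + y * (a + a′ + x) * k
      regroup = solve-∀
      expand : (D a + D (σE a)) + (Q a + Q (σE a)) ≡ χ T (src a) * ρ (tgt a) * f a + χ T (tgt a) * ρ (src a) * f a
      expand rewrite src-σE a | tgt-σE a | symmetric a | χT-σ (src a) | χT-σ (tgt a) =
        regroup (χ S (src a)) (χ S (σV (src a))) (χ T (src a))
                (χ S (tgt a)) (χ S (σV (tgt a))) (χ T (tgt a)) (f a)

    sum-W : sum W ≡ K * 2
    sum-W = trans (∑-distrib-+ (λ a → half (src a) * f a) (λ a → half (tgt a) * f a))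
                  (trans (cong (K +_) K-tgt) (double K))
      where
      double : ∀ k → k + k ≡ k * 2
      double = solve-∀

    P : ℕ
    P = sum (λ a → if does (a <? σE a) then Q a else 0)

    sum-Q : sum Q ≡ P * 2
    sum-Q = trans (sum-pairs σE σE-invol σE-fixfree Q)
      (trans (sum-cong-≗ pair) (trans (sum-*ˡ 2 (λ a → if does (a <? σE a) then Q a else 0)) (*-comm 2 P)))
      where
      Q-σ : ∀ a → Q (σE a) ≡ Q a
      Q-σ a rewrite src-σE a | tgt-σE a | symmetric a | χT-σ (src a) | χT-σ (tgt a) =
        cong (_* f a) (*-comm (χ T (tgt a)) (χ T (src a)))
      pair : ∀ a → (if does (a <? σE a) then Q a + Q (σE a) else 0) ≡ 2 * (if does (a <? σE a) then Q a else 0)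
      pair a with does (a <? σE a)
      ... | true  = cong (Q a +_) (trans (Q-σ a) (sym (+-identityʳ (Q a))))
      ... | false = refl

    sum-D : leaving S T + entering S T ≡ sum D
    sum-D = trans (cong₂ _+_ (between-χ src tgt S T f) (between-χ tgt src S T f))
      (sym (∑-distrib-+ (λ a → χ S (src a) * χ T (tgt a) * f a) (λ a → χ S (tgt a) * χ T (src a) * f a)))

    even : leaving S T + entering S T + P * 2 ≡ K * 2
    even = begin
      leaving S T + entering S T + P * 2 ≡⟨ cong₂ _+_ sum-D (sym sum-Q) ⟩
      sum D + sum Q                      ≡⟨ ∑-distrib-+ D Q ⟨
      sum (λ a → D a + Q a)              ≡⟨ sum-pairs σE σE-invol σE-fixfree (λ a → D a + Q a) ⟩
      sum (λ a → if does (a <? σE a) then D a + Q a + (D (σE a) + Q (σE a)) else 0)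
        ≡⟨ sum-cong-≗ (λ a → cong (if does (a <? σE a) then_else 0)
             (trans (+-interchange (D a) (Q a) (D (σE a)) (Q (σE a))) (sym (D-pair a)))) ⟩
      sum (λ a → if does (a <? σE a) then W a + W (σE a) else 0)
                                         ≡⟨ sum-pairs σE σE-invol σE-fixfree W ⟨
      sum W                              ≡⟨ sum-W ⟩
      K * 2                              ∎
      where
      open ≡-Reasoning

-- The residual network

↑-elim : ∀ {ℓ} {P : Fin (m + n) → Set ℓ} → (∀ i → P (i ↑ˡ n)) → (∀ j → P (m ↑ʳ j)) → ∀ i → P i
↑-elim {m} {n} {P = P} l r i = subst P (join-splitAt m n i) (go (splitAt m i))
  where
  go : ∀ x → P (join m n x)
  go (inj₁ i) = l i
  go (inj₂ j) = r j

module Residual (N : SkewSymmetricNetwork n m) (F : ISFlow N) where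
  open SkewSymmetricNetwork N
  open ISFlow F
  open Flow N F

  fwd bwd : Fin m → Fin (m + m)
  fwd a = a ↑ˡ m
  bwd a = m ↑ʳ a

  both : {B : Set} → (Fin m → B) → (Fin m → B) → Fin (m + m) → B
  both g h i = [ g , h ]′ (splitAt m i)

  both-fwd : {B : Set} (g h : Fin m → B) → ∀ a → both g h (fwd a) ≡ g a
  both-fwd g h a = cong [ g , h ]′ (splitAt-↑ˡ m a m)

  both-bwd : {B : Set} (g h : Fin m → B) → ∀ a → both g h (bwd a) ≡ h a
  both-bwd g h a = cong [ g , h ]′ (splitAt-↑ʳ m m a)

  srcᴿ tgtᴿ : Fin (m + m) → Fin n
  srcᴿ = both src tgt
  tgtᴿ = both tgt src

  σᴿ : Fin (m + m) → Fin (m + m)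
  σᴿ = both (fwd ∘ σE) (bwd ∘ σE)

  uᴿ : Fin (m + m) → ℕ
  uᴿ = both (λ a → u a ∸ f a) f

  σᴿ-fwd : ∀ a → σᴿ (fwd a) ≡ fwd (σE a)
  σᴿ-fwd = both-fwd (fwd ∘ σE) (bwd ∘ σE)

  σᴿ-bwd : ∀ a → σᴿ (bwd a) ≡ bwd (σE a)
  σᴿ-bwd = both-bwd (fwd ∘ σE) (bwd ∘ σE)

  uᴿ-fwd : ∀ a → uᴿ (fwd a) ≡ u a ∸ f a
  uᴿ-fwd = both-fwd (λ a → u a ∸ f a) f

  uᴿ-bwd : ∀ a → uᴿ (bwd a) ≡ f a
  uᴿ-bwd = both-bwd (λ a → u a ∸ f a) f

  residual : SkewSymmetricNetwork n (m + m)
  residual = record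
    { graph = record
      { src        = srcᴿ
      ; tgt        = tgtᴿ
      ; σV         = σV
      ; σE         = σᴿ
      ; σV-fixfree = σV-fixfree
      ; σE-fixfree = ↑-elim (λ a eq → σE-fixfree a (↑ˡ-injective m _ _ (trans (sym (σᴿ-fwd a)) eq)))
                            (λ a eq → σE-fixfree a (↑ʳ-injective m _ _ (trans (sym (σᴿ-bwd a)) eq)))
      ; σV-invol   = σV-invol
      ; σE-invol   = ↑-elim
          (λ a → trans (cong σᴿ (σᴿ-fwd a)) (trans (σᴿ-fwd (σE a)) (cong fwd (σE-invol a))))
          (λ a → trans (cong σᴿ (σᴿ-bwd a)) (trans (σᴿ-bwd (σE a)) (cong bwd (σE-invol a))))
      ; src-σE     = ↑-elim
          (λ a → trans (cong srcᴿ (σᴿ-fwd a)) (trans (both-fwd src tgt (σE a))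
                   (trans (src-σE a) (cong σV (sym (both-fwd tgt src a))))))
          (λ a → trans (cong srcᴿ (σᴿ-bwd a)) (trans (both-bwd src tgt (σE a))
                   (trans (tgt-σE a) (cong σV (sym (both-bwd tgt src a))))))
      ; tgt-σE     = ↑-elim
          (λ a → trans (cong tgtᴿ (σᴿ-fwd a)) (trans (both-fwd tgt src (σE a))
                   (trans (tgt-σE a) (cong σV (sym (both-fwd src tgt a))))))
          (λ a → trans (cong tgtᴿ (σᴿ-bwd a)) (trans (both-bwd tgt src (σE a))
                   (trans (src-σE a) (cong σV (sym (both-bwd src tgt a))))))
      }
    ; u           = uᴿ
    ; u-symmetric = ↑-elim
        (λ a → trans (cong uᴿ (σᴿ-fwd a)) (trans (uᴿ-fwd (σE a))
                 (trans (cong₂ _∸_ (u-symmetric a) (symmetric a)) (sym (uᴿ-fwd a)))))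
        (λ a → trans (cong uᴿ (σᴿ-bwd a)) (trans (uᴿ-bwd (σE a)) (trans (symmetric a) (sym (uᴿ-bwd a)))))
    ; s           = s
    }

  capacity-residual : ∀ S T → capacityBetween residual S T + leaving S T ≡ capacityBetween N S T + entering S T
  capacity-residual S T = begin
    capacityBetween residual S T + leaving S T
      ≡⟨ cong (_+ leaving S T) (sum-↑ m _) ⟩
    sum (λ a → term (fwd a)) + sum (λ a → term (bwd a)) + leaving S T
      ≡⟨ cong₂ (λ x y → x + y + leaving S T) (sum-cong-≗ term-fwd) (sum-cong-≗ term-bwd) ⟩
    between src tgt S T (λ a → u a ∸ f a) + entering S T + leaving S T
      ≡⟨ rotate (between src tgt S T (λ a → u a ∸ f a)) _ _ ⟩
    between src tgt S T (λ a → u a ∸ f a) + leaving S T + entering S T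
      ≡⟨ cong (_+ entering S T) (between-+ src tgt S T (λ a → m∸n+n≡m (capacity a))) ⟩
    capacityBetween N S T + entering S T ∎
    where
    open ≡-Reasoning
    rotate : ∀ x y z → x + y + z ≡ x + z + y
    rotate = solve-∀
    Term : Fin n → Fin n → ℕ → ℕ
    Term v w x = if does ((v ∈? S) ×-dec (w ∈? T)) then x else 0
    term : Fin (m + m) → ℕ
    term i = Term (srcᴿ i) (tgtᴿ i) (uᴿ i)
    term-fwd : ∀ a → term (fwd a) ≡ Term (src a) (tgt a) (u a ∸ f a)
    term-fwd a = trans (cong₂ (λ v w → Term v w (uᴿ (fwd a))) (both-fwd src tgt a) (both-fwd tgt src a))
                       (cong (Term (src a) (tgt a)) (uᴿ-fwd a))
    term-bwd : ∀ a → term (bwd a) ≡ Term (tgt a) (src a) (f a)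
    term-bwd a = trans (cong₂ (λ v w → Term v w (uᴿ (bwd a))) (both-bwd src tgt a) (both-bwd tgt src a))
                       (cong (Term (tgt a) (src a)) (uᴿ-bwd a))

  residual-cut : ∀ S → s ∈ S → s′ ∉ S →
                 capacityBetween residual S (∁ S) + out-s ≡ capacityBetween N S (∁ S) + in-s
  residual-cut S s∈S s′∉S = +-cancelʳ-≡ (entering S (∁ S)) _ _ (begin
    capᴿ + out-s + entering S (∁ S)   ≡⟨ rotate capᴿ out-s _ ⟩
    capᴿ + (entering S (∁ S) + out-s) ≡⟨ cong (capᴿ +_) (cut-balance S s∈S s′∉S) ⟨
    capᴿ + (leaving S (∁ S) + in-s)   ≡⟨ +-assoc capᴿ _ _ ⟨
    capᴿ + leaving S (∁ S) + in-s     ≡⟨ cong (_+ in-s) (capacity-residual S (∁ S)) ⟩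
    capᴺ + entering S (∁ S) + in-s    ≡⟨ rotate′ capᴺ _ in-s ⟩
    capᴺ + in-s + entering S (∁ S)    ∎)
    where
    open ≡-Reasoning
    capᴿ capᴺ : ℕ
    capᴿ = capacityBetween residual S (∁ S)
    capᴺ = capacityBetween N S (∁ S)
    rotate : ∀ x y z → x + y + z ≡ x + (z + y)
    rotate = solve-∀
    rotate′ : ∀ x y z → x + y + z ≡ x + z + y
    rotate′ = solve-∀

  reverse-joins : ∀ {P Q P′ Q′ : Set} → (P × Q) ⊎ (P′ × Q′) → (Q′ × P′) ⊎ (Q × P)
  reverse-joins (inj₁ (p , q)) = inj₂ (q , p)
  reverse-joins (inj₂ (p , q)) = inj₁ (q , p)

  noArc⁺ : ∀ {S T} → NoPositiveArc N S T → NoPositiveArc residual S T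
  noArc⁺ {S} {T} none (i , 0<uᴿ , joins) = ↑-elim
    {P = λ i → 0 < uᴿ i → (srcᴿ i ∈ S × tgtᴿ i ∈ T) ⊎ (srcᴿ i ∈ T × tgtᴿ i ∈ S) → ⊥}
    (λ a 0<ua∸fa joins → none (a ,
      ≤-trans (subst (0 <_) (uᴿ-fwd a) 0<ua∸fa) (m∸n≤m (u a) (f a)) ,
      subst₂ (λ v w → (v ∈ S × w ∈ T) ⊎ (v ∈ T × w ∈ S)) (both-fwd src tgt a) (both-fwd tgt src a) joins))
    (λ a 0<fa joins → none (a ,
      ≤-trans (subst (0 <_) (uᴿ-bwd a) 0<fa) (capacity a) ,
      reverse-joins (subst₂ (λ v w → (v ∈ S × w ∈ T) ⊎ (v ∈ T × w ∈ S))
                            (both-bwd src tgt a) (both-bwd tgt src a) joins)))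
    i 0<uᴿ joins

  noArc⁻ : ∀ {S T} → NoPositiveArc residual S T → NoPositiveArc N S T
  noArc⁻ {S} {T} none (a , 0<ua , joins) with f a ≟ℕ 0
  ... | yes fa≡0 = none (fwd a , subst (0 <_) (sym (trans (uᴿ-fwd a) (cong (u a ∸_) fa≡0))) 0<ua ,
    subst₂ (λ v w → (v ∈ S × w ∈ T) ⊎ (v ∈ T × w ∈ S)) (sym (both-fwd src tgt a)) (sym (both-fwd tgt src a)) joins)
  ... | no fa≢0 = none (bwd a , subst (0 <_) (sym (uᴿ-bwd a)) (n≢0⇒n>0 fa≢0) ,
    subst₂ (λ v w → (v ∈ S × w ∈ T) ⊎ (v ∈ T × w ∈ S)) (sym (both-bwd src tgt a)) (sym (both-bwd tgt src a))
      (reverse-joins joins))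

  -- The parity condition (O4) is the only part of an odd barrier that mentions
  -- the capacities themselves and not just their support.
  parity : ∀ {k} (A : Subset n) (X : Fin k → Subset n) →
           let M = ∁ (A ∪ image σV A ∪ ⋃ (tabulate X)) in
           (∀ i → Empty (A ∩ X i)) → s ∈ A → Empty (A ∩ image σV A) → (∀ i → image σV (X i) ≡ X i) →
           (∀ i j → i ≢ j → NoPositiveArc N (X i) (X j)) → (∀ i → NoPositiveArc N (X i) M) →
           ∀ i → capacityBetween residual A (X i) % 2 ≡ capacityBetween N A (X i) % 2
  parity {k} A X A∩X s∈A A∩σA X-σ XX XM i = begin
    capᴿ % 2                              ≡⟨ [m+kn]%n≡m%n capᴿ K 2 ⟨
    (capᴿ + K * 2) % 2                    ≡⟨ cong (_% 2) same ⟩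
    (capᴺ + (entering A (X i) + P) * 2) % 2 ≡⟨ [m+kn]%n≡m%n capᴺ (entering A (X i) + P) 2 ⟩
    capᴺ % 2                              ∎
    where
    open ≡-Reasoning
    capᴿ capᴺ : ℕ
    capᴿ = capacityBetween residual A (X i)
    capᴺ = capacityBetween N A (X i)
    A∌X : ∀ {v} → v ∈ X i → v ∉ A
    A∌X v∈X v∈A = A∩X i (_ , x∈p∩q⁺ (v∈A , v∈X))
    X-closed : ∀ {v} → v ∈ X i → σV v ∈ X i
    X-closed {v} v∈X = ∈-image⁻ graph (subst (v ∈_) (sym (X-σ i)) v∈X)
    A-σ : ∀ v → v ∈ A → σV v ∉ A
    A-σ v v∈A σv∈A = A∩σA (v , x∈p∩q⁺ (v∈A , ∈-image⁺ graph σv∈A))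
    from-X : ∀ a → 0 < f a → src a ∈ X i → tgt a ∈ A ⊎ σV (tgt a) ∈ A ⊎ tgt a ∈ X i
    from-X a 0<fa src∈X with tgt a ∈? A ∪ image σV A ∪ ⋃ (tabulate X)
    ... | no tgt∉ = contradiction (a , ≤-trans 0<fa (capacity a) , inj₁ (src∈X , x∉p⇒x∈∁p tgt∉)) (XM i)
    ... | yes tgt∈ with x∈p∪q⁻ A _ tgt∈
    ...   | inj₁ tgt∈A = inj₁ tgt∈A
    ...   | inj₂ tgt∈′ with x∈p∪q⁻ (image σV A) _ tgt∈′
    ...     | inj₁ tgt∈σA = inj₂ (inj₁ (∈-image⁻ graph tgt∈σA))
    ...     | inj₂ tgt∈⋃ with j , tgt∈Xⱼ ← ∈-⋃⁻ X tgt∈⋃ with i ≟ j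
    ...       | yes refl = inj₂ (inj₂ tgt∈Xⱼ)
    ...       | no i≢j = contradiction (a , ≤-trans 0<fa (capacity a) , inj₁ (src∈X , tgt∈Xⱼ)) (XX i j i≢j)
    open Parity A (X i) X-closed (λ s∈X → A∌X s∈X s∈A)
      (λ s′∈X → A∌X (subst (_∈ X i) (σV-invol s) (X-closed s′∈X)) s∈A)
      (λ v v∈X → A∌X v∈X , A∌X (X-closed v∈X)) A-σ from-X
    same : capᴿ + K * 2 ≡ capᴺ + (entering A (X i) + P) * 2
    same = begin
      capᴿ + K * 2                                            ≡⟨ cong (capᴿ +_) even ⟨
      capᴿ + (leaving A (X i) + entering A (X i) + P * 2)     ≡⟨ left capᴿ (leaving A (X i)) _ P ⟩
      (capᴿ + leaving A (X i)) + (entering A (X i) + P * 2)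
        ≡⟨ cong (_+ (entering A (X i) + P * 2)) (capacity-residual A (X i)) ⟩
      (capᴺ + entering A (X i)) + (entering A (X i) + P * 2)  ≡⟨ right capᴺ (entering A (X i)) P ⟩
      capᴺ + (entering A (X i) + P) * 2                       ∎
      where
      left : ∀ w x y z → w + (x + y + z * 2) ≡ (w + x) + (y + z * 2)
      left = solve-∀
      right : ∀ x y z → (x + y) + (y + z * 2) ≡ x + (y + z) * 2
      right = solve-∀

  barrier⁺ : OddBarrier N → OddBarrier residual
  barrier⁺ B = record
    { k = k ; A = A ; X = X
    ; A-X-disjoint  = A-X-disjoint
    ; X-X-disjoint  = X-X-disjoint
    ; s∈A           = s∈A
    ; A-σA-disjoint = A-σA-disjoint
    ; X-σ-invariant = X-σ-invariant
    ; A-X-odd       = λ i → trans (parity A X A-X-disjoint s∈A A-σA-disjoint X-σ-invariant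
                                X-X-noArc X-M-noArc i) (A-X-odd i)
    ; X-X-noArc     = λ i j i≢j → noArc⁺ (X-X-noArc i j i≢j)
    ; X-M-noArc     = λ i → noArc⁺ (X-M-noArc i)
    }
    where open OddBarrier B

  barrier⁻ : OddBarrier residual → OddBarrier N
  barrier⁻ B = record
    { k = k ; A = A ; X = X
    ; A-X-disjoint  = A-X-disjoint
    ; X-X-disjoint  = X-X-disjoint
    ; s∈A           = s∈A
    ; A-σA-disjoint = A-σA-disjoint
    ; X-σ-invariant = X-σ-invariant
    ; A-X-odd       = λ i → trans (sym (parity A X A-X-disjoint s∈A A-σA-disjoint X-σ-invariant
                                     (λ i j i≢j → noArc⁻ (X-X-noArc i j i≢j)) (λ i → noArc⁻ (X-M-noArc i)) i)) (A-X-odd i)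
    ; X-X-noArc     = λ i j i≢j → noArc⁻ (X-X-noArc i j i≢j)
    ; X-M-noArc     = λ i → noArc⁻ (X-M-noArc i)
    }
    where open OddBarrier B

⊖-shift : ∀ w x y z → w + x ≡ y + z → w ⊖ z ≡ y ⊖ x
⊖-shift w x y z w+x≡y+z = begin
  w ⊖ z             ≡⟨ cancel x w z ⟨
  (x + w) ⊖ (x + z) ≡⟨ cong₂ _⊖_ (trans (+-comm x w) (trans w+x≡y+z (+-comm y z))) (+-comm x z) ⟩
  (z + y) ⊖ (z + x) ≡⟨ cancel z y x ⟩
  y ⊖ x             ∎
  where
  open ≡-Reasoning
  cancel : ∀ o m n → (o + m) ⊖ (o + n) ≡ m ⊖ n
  cancel zero    m n = refl
  cancel (suc o) m n = trans (ℤₚ.[1+m]⊖[1+n]≡m⊖n (o + m) (o + n)) (cancel o m n)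

weak-duality : (N : SkewSymmetricNetwork n m) (F : ISFlow N) (B : OddBarrier N) →
               flowValue N F ℤ.≤ barrierCapacity N B
weak-duality N F B = begin
  out-s ⊖ in-s          ≡⟨ ⊖-shift out-s capᴿ capᴺ in-s (trans (+-comm out-s capᴿ) (residual-cut A s∈A (s′∉A N B))) ⟩
  capᴺ ⊖ capᴿ           ≤⟨ ℤₚ.⊖-monoʳ-≥-≤ capᴺ (k≤capacity residual (barrier⁺ B)) ⟩
  capᴺ ⊖ k              ∎
  where
  open ℤₚ.≤-Reasoning
  open Flow N F
  open Residual N F
  open OddBarrier B
  capᴿ capᴺ : ℕ
  capᴿ = capacityBetween residual A (∁ A)
  capᴺ = capacityBetween N A (∁ A)

module _ (N : SkewSymmetricNetwork n m) (F : ISFlow N) where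
  open SkewSymmetricNetwork N
  open Residual N F
  open Flow N F
  open Walks (SkewSymmetricNetwork.graph residual)

  optimal-barrier : ¬ Reach uᴿ s s′ → ∃ λ (B : OddBarrier N) → barrierCapacity N B ≡ flowValue N F
  optimal-barrier ¬reach with B , cap≡k ← Barrier.tight-barrier residual ¬reach = barrier⁻ B ,
    sym (⊖-shift out-s (OddBarrier.k B) _ in-s (trans (+-comm out-s (OddBarrier.k B))
      (trans (cong (_+ out-s) (sym cap≡k)) (residual-cut (OddBarrier.A B) (OddBarrier.s∈A B) (s′∉A residual B)))))

-- Augmentation

sumOver-zero : ∀ {ℓ} {P : Pred (Fin m) ℓ} (P? : Decidable P) → sumOver P? (λ _ → 0) ≡ 0
sumOver-zero P? = sum-zero (λ a → if-eta (does (P? a)))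

sumOver-+ : ∀ {ℓ} {P : Pred (Fin m) ℓ} (P? : Decidable P) (g h : Fin m → ℕ) →
            sumOver P? (λ a → g a + h a) ≡ sumOver P? g + sumOver P? h
sumOver-+ P? g h = trans (sum-cong-≗ split)
  (∑-distrib-+ (λ a → if does (P? a) then g a else 0) (λ a → if does (P? a) then h a else 0))
  where
  split : ∀ a → (if does (P? a) then g a + h a else 0) ≡
                (if does (P? a) then g a else 0) + (if does (P? a) then h a else 0)
  split a with does (P? a)
  ... | true  = refl
  ... | false = refl

sumOver-cong : ∀ {ℓ} {P : Pred (Fin m) ℓ} (P? : Decidable P) {g h : Fin m → ℕ} →
               (∀ a → g a ≡ h a) → sumOver P? g ≡ sumOver P? h
sumOver-cong P? g≡h = sum-cong-≗ (λ a → cong (if does (P? a) then_else 0) (g≡h a))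

sumOver-δ : ∀ (φ : Fin m → Fin n) v b → sumOver (λ a → φ a ≟ v) (λ a → δ a b) ≡ δ v (φ b)
sumOver-δ φ v b = trans (sum-single b off) on
  where
  off : ∀ a → a ≢ b → (if does (φ a ≟ v) then δ a b else 0) ≡ 0
  off a a≢b with does (φ a ≟ v)
  ... | true  = δ-≢ a≢b
  ... | false = refl
  on : (if does (φ b ≟ v) then δ b b else 0) ≡ δ v (φ b)
  on with φ b ≟ v
  ... | yes refl = trans (δ-refl b) (sym (δ-refl (φ b)))
  ... | no φb≢v  = sym (δ-≢ (φb≢v ∘ sym))

module _ (G : SkewSymmetricGraph n m) where
  open SkewSymmetricGraph G
  open Walks G

  private
    out in′ : (Fin m → ℕ) → Fin n → ℕ
    out g v = sumOver (λ a → src a ≟ v) g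
    in′ g v = sumOver (λ a → tgt a ≟ v) g

  count-balance : ∀ {x} p {y} → Walk x p y → ∀ v →
                  out (λ a → count a p) v + δ v y ≡ in′ (λ a → count a p) v + δ v x
  count-balance []      refl          v =
    cong (_+ δ v _) (trans (sumOver-zero (λ a → src a ≟ v)) (sym (sumOver-zero (λ a → tgt a ≟ v))))
  count-balance (b ∷ p) {y} (refl , walk) v = begin
    out (λ a → δ a b + count a p) v + δ v y
      ≡⟨ cong (_+ δ v y) (trans (sumOver-+ (λ a → src a ≟ v) (λ a → δ a b) (λ a → count a p))
           (cong (_+ out (λ a → count a p) v) (sumOver-δ src v b))) ⟩
    δ v (src b) + out (λ a → count a p) v + δ v y
      ≡⟨ +-assoc (δ v (src b)) _ _ ⟩
    δ v (src b) + (out (λ a → count a p) v + δ v y)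
      ≡⟨ cong (δ v (src b) +_) (count-balance p walk v) ⟩
    δ v (src b) + (in′ (λ a → count a p) v + δ v (tgt b))
      ≡⟨ rotate (δ v (src b)) _ (δ v (tgt b)) ⟩
    δ v (tgt b) + in′ (λ a → count a p) v + δ v (src b)
      ≡⟨ cong (_+ δ v (src b)) (trans (sumOver-+ (λ a → tgt a ≟ v) (λ a → δ a b) (λ a → count a p))
           (cong (_+ in′ (λ a → count a p) v) (sumOver-δ tgt v b))) ⟨
    in′ (λ a → δ a b + count a p) v + δ v (src b) ∎
    where
    open ≡-Reasoning
    rotate : ∀ x y z → x + (y + z) ≡ z + y + x
    rotate = solve-∀

  use-balance : ∀ {x} p → Walk x p (σV x) → ∀ v →
                out (λ a → use a p) v + 2 * δ v (σV x) ≡ in′ (λ a → use a p) v + 2 * δ v x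
  use-balance {x} p walk v = begin
    out (λ a → use a p) v + 2 * δ v (σV x)
      ≡⟨ cong (_+ 2 * δ v (σV x)) (expand src) ⟩
    out c v + out c′ v + 2 * δ v (σV x)
      ≡⟨ pair (out c v) _ _ ⟩
    (out c v + δ v (σV x)) + (out c′ v + δ v (σV x))
      ≡⟨ cong₂ _+_ (count-balance p walk v) (count-balance (mirror p) mirror-walk v) ⟩
    (in′ c v + δ v x) + (in′ c′ v + δ v x)
      ≡⟨ pair (in′ c v) _ _ ⟨
    in′ c v + in′ c′ v + 2 * δ v x
      ≡⟨ cong (_+ 2 * δ v x) (expand tgt) ⟨
    in′ (λ a → use a p) v + 2 * δ v x ∎
    where
    open ≡-Reasoning
    c c′ : Fin m → ℕ
    c a  = count a p
    c′ a = count a (mirror p)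
    mirror-walk : Walk x (mirror p) (σV x)
    mirror-walk = subst (λ w → Walk w (mirror p) (σV x)) (σV-invol x) (walk-mirror p walk)
    expand : ∀ (φ : Fin m → Fin n) → sumOver (λ a → φ a ≟ v) (λ a → use a p) ≡
             sumOver (λ a → φ a ≟ v) c + sumOver (λ a → φ a ≟ v) c′
    expand φ = trans (sumOver-cong (λ a → φ a ≟ v) (λ a → cong (c a +_) (sym (count-mirror a p))))
                     (sumOver-+ (λ a → φ a ≟ v) c c′)
    pair : ∀ x y z → x + y + 2 * z ≡ (x + z) + (y + z)
    pair = solve-∀

module Augment (N : SkewSymmetricNetwork n m) (F : ISFlow N) where
  open SkewSymmetricNetwork N
  open ISFlow F
  open Residual N F
  open Walks (SkewSymmetricNetwork.graph residual)

  module _ (p : List (Fin (m + m))) (walk : Walk s p s′) (reg : Regular uᴿ p) where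

    U V f′ : Fin m → ℕ
    U a  = use (fwd a) p
    V a  = use (bwd a) p
    f′ a = (f a + U a) ∸ V a

    V≤f : ∀ a → V a ≤ f a
    V≤f a = ≤-trans (reg (bwd a)) (≤-reflexive (uᴿ-bwd a))

    f′+V : ∀ a → f′ a + V a ≡ f a + U a
    f′+V a = m∸n+n≡m (≤-trans (V≤f a) (m≤m+n (f a) (U a)))

    f′≤u : ∀ a → f′ a ≤ u a
    f′≤u a = begin
      f′ a            ≤⟨ m∸n≤m (f a + U a) (V a) ⟩
      f a + U a       ≤⟨ +-monoʳ-≤ (f a) (≤-trans (reg (fwd a)) (≤-reflexive (uᴿ-fwd a))) ⟩
      f a + (u a ∸ f a) ≡⟨ m+[n∸m]≡n (capacity a) ⟩
      u a             ∎
      where open ≤-Reasoning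

    f′-sym : Symmetric f′
    f′-sym a = cong₂ _∸_
      (cong₂ _+_ (symmetric a) (trans (cong (λ i → use i p) (sym (σᴿ-fwd a))) (use-σ (fwd a) p)))
      (trans (cong (λ i → use i p) (sym (σᴿ-bwd a))) (use-σ (bwd a) p))

    module _ (v : Fin n) where
      o i : (Fin m → ℕ) → ℕ
      o g = outflow N g v
      i g = inflow N g v

      update : ∀ (φ : Fin m → Fin n) → let ∑ᵥ = sumOver (λ a → φ a ≟ v) in ∑ᵥ f′ + ∑ᵥ V ≡ ∑ᵥ f + ∑ᵥ U
      update φ = trans (sym (sumOver-+ (λ a → φ a ≟ v) f′ V))
        (trans (sumOver-cong (λ a → φ a ≟ v) f′+V) (sumOver-+ (λ a → φ a ≟ v) f U))

      split : ∀ (φ ψ : Fin m → Fin n) → sumOver (λ i → both φ ψ i ≟ v) (λ i → use i p) ≡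
              sumOver (λ a → φ a ≟ v) U + sumOver (λ a → ψ a ≟ v) V
      split φ ψ = trans (sum-↑ m _) (cong₂ _+_
        (sum-cong-≗ (λ a → cong (λ w → if does (w ≟ v) then U a else 0) (both-fwd φ ψ a)))
        (sum-cong-≗ (λ a → cong (λ w → if does (w ≟ v) then V a else 0) (both-bwd φ ψ a))))

      walk-balance : o U + i V + 2 * δ v s′ ≡ i U + o V + 2 * δ v s
      walk-balance = trans (cong (_+ 2 * δ v s′) (sym (split src tgt)))
        (trans (use-balance (SkewSymmetricNetwork.graph residual) p walk v) (cong (_+ 2 * δ v s) (split tgt src)))

      net : o f′ + i f + 2 * δ v s′ ≡ o f + i f′ + 2 * δ v s
      net = +-cancelʳ-≡ (o V + i V + i U) _ _ (begin
        o f′ + i f + 2 * δ v s′ + (o V + i V + i U)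
          ≡⟨ r₁ (o f′) (i f) (2 * δ v s′) (o V) (i V) (i U) ⟩
        (o f′ + o V) + (i f + i U) + (i V + 2 * δ v s′)
          ≡⟨ cong₂ (λ x y → x + y + (i V + 2 * δ v s′)) (update src) (sym (update tgt)) ⟩
        (o f + o U) + (i f′ + i V) + (i V + 2 * δ v s′)
          ≡⟨ r₂ (o f) (o U) (i f′) (i V) (2 * δ v s′) ⟩
        (o f + i f′ + i V) + (o U + i V + 2 * δ v s′)
          ≡⟨ cong (o f + i f′ + i V +_) walk-balance ⟩
        (o f + i f′ + i V) + (i U + o V + 2 * δ v s)
          ≡⟨ r₃ (o f) (i f′) (i V) (i U) (o V) (2 * δ v s) ⟩
        o f + i f′ + 2 * δ v s + (o V + i V + i U) ∎)
        where
        open ≡-Reasoning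
        r₁ : ∀ a b c d e f → a + b + c + (d + e + f) ≡ (a + d) + (b + f) + (e + c)
        r₁ = solve-∀
        r₂ : ∀ a b c d e → (a + b) + (c + d) + (d + e) ≡ (a + c + d) + (b + d + e)
        r₂ = solve-∀
        r₃ : ∀ a b c d e f → (a + b + c) + (d + e + f) ≡ a + b + f + (e + c + d)
        r₃ = solve-∀

    augmented : ISFlow N
    augmented = record
      { f            = f′
      ; capacity     = f′≤u
      ; conservation = conserve
      ; symmetric    = f′-sym
      }
      where
      conserve : ∀ v → v ≢ s → v ≢ s′ → outflow N f′ v ≡ inflow N f′ v
      conserve v v≢s v≢s′ with eq ← net v rewrite δ-≢ v≢s | δ-≢ v≢s′ | conservation v v≢s v≢s′ =
        +-cancelʳ-≡ (inflow N f v) _ _ (trans (sym (+-identityʳ _)) (trans eq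
          (trans (+-identityʳ _) (+-comm (inflow N f v) _))))

    augmented-value : outflow N f′ s + inflow N f s ≡ outflow N f s + inflow N f′ s + 2
    augmented-value with eq ← net s rewrite δ-refl s | δ-≢ (σV-fixfree s ∘ sym) =
      trans (sym (+-identityʳ _)) eq

module Optimum (N : SkewSymmetricNetwork n m) where
  open SkewSymmetricNetwork N

  out-s in-s : ISFlow N → ℕ
  out-s F = outflow N (ISFlow.f F) s
  in-s F  = inflow N (ISFlow.f F) s

  out-bound : ∀ F → out-s F ≤ sum u
  out-bound F = sum-mono-≤ bound
    where
    bound : ∀ a → (if does (src a ≟ s) then ISFlow.f F a else 0) ≤ u a
    bound a with does (src a ≟ s)
    ... | true  = ISFlow.capacity F a
    ... | false = z≤n

  augment-until-optimal : ∀ fuel F → sum u + in-s F < out-s F + fuel →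
             ∃ λ F → ∃ λ (B : OddBarrier N) → barrierCapacity N B ≡ flowValue N F
  augment-until-optimal zero F slack = contradiction
    (≤-trans slack (≤-trans (≤-reflexive (+-identityʳ (out-s F))) (≤-trans (out-bound F) (m≤m+n (sum u) (in-s F)))))
    (<-irrefl refl)
  augment-until-optimal (suc fuel) F slack
    with Walks.reach? (SkewSymmetricNetwork.graph (Residual.residual N F)) (Residual.uᴿ N F) s s′
  ... | no ¬reach = F , optimal-barrier N F ¬reach
  ... | yes (p , walk , reg) = augment-until-optimal fuel F′ (+-cancelʳ-< (in-s F) _ _ (begin-strict
      sum u + in-s F′ + in-s F              ≡⟨ r₁ (sum u) (in-s F′) (in-s F) ⟩
      sum u + in-s F + in-s F′              <⟨ +-monoˡ-< (in-s F′) slack ⟩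
      out-s F + suc fuel + in-s F′          ≤⟨ n≤1+n _ ⟩
      suc (out-s F + suc fuel + in-s F′)    ≡⟨ r₂ (out-s F) fuel (in-s F′) ⟩
      out-s F + in-s F′ + 2 + fuel          ≡⟨ cong (_+ fuel) (Augment.augmented-value N F p walk reg) ⟨
      out-s F′ + in-s F + fuel              ≡⟨ r₃ (out-s F′) (in-s F) fuel ⟩
      out-s F′ + fuel + in-s F              ∎))
    where
    open ≤-Reasoning
    F′ : ISFlow N
    F′ = Augment.augmented N F p walk reg
    r₁ : ∀ a b c → a + b + c ≡ a + c + b
    r₁ = solve-∀
    r₂ : ∀ a b c → suc (a + suc b + c) ≡ a + c + 2 + b
    r₂ = solve-∀
    r₃ : ∀ a b c → a + b + c ≡ a + c + b
    r₃ = solve-∀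

  zero-flow : ISFlow N
  zero-flow = record
    { f            = λ _ → 0
    ; capacity     = λ _ → z≤n
    ; conservation = λ v _ _ → trans (sumOver-zero (λ a → src a ≟ v)) (sym (sumOver-zero (λ a → tgt a ≟ v)))
    ; symmetric    = λ _ → refl
    }

  duality : ∃ λ F → ∃ λ (B : OddBarrier N) → barrierCapacity N B ≡ flowValue N F
  duality = augment-until-optimal (suc (sum u + in-s zero-flow)) zero-flow (m≤n+m _ (out-s zero-flow))

mainTheorem6 : ∀ (n m : ℕ) (N : SkewSymmetricNetwork n m) →
    ∃ λ (z : ℤ) → IsMaximumOf (flowValue N) z × IsMinimumOf (barrierCapacity N) z
mainTheorem6 n m N with F , B , cap≡value ← Optimum.duality N =
  flowValue N F ,
  ((F , refl) , λ F′ → ℤₚ.≤-trans (weak-duality N F′ B) (ℤₚ.≤-reflexive cap≡value)) ,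
  ((B , cap≡value) , λ B′ → weak-duality N F B′)
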